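{- There exist functions $f:\{0,1\}^n\times\{0,1\}^n\to\{0,1\}$ (one for each $n$) such that every deterministic branching program computing $f$ has size $\Omega\left(\frac{2^n}{n}\right)$, but $\mathrm{upd}(f)\le O(n)$ with respect to any balanced partition of the $2n$ input variables into two parts.
   Context: A balanced partition splits the $2n$ input variables into two parts of $n$ variables each. For such a partition, the bipartite graph of $f$ has sides $U=\{0,1\}^n$ and $V=\{0,1\}^n$ (the assignments to the first and second part), with $(u,v)$ an edge iff $f$ equals $1$ on the combined assignment. $\mathrm{upd}(f)$ with respect to the partition is the smallest $d$ such that there is a map $\phi$ assigning to each vertex of $U\cup V$ a linear subspace of a $d$-dimensional vector space over $\mathbb{F}_2$, such that for all $(u,v)\in U\times V$: $\phi(u)\cap\phi(v)\ne\{0\}$ iff $(u,v)$ is an edge, and $\dim(\phi(u)\cap\phi(v))\le 1$. Deterministic branching program: a directed acyclic graph with distinct start, accept and reject nodes; accept and reject have out-degree $0$; every other vertex is labelled by an input variable and has two outgoing edges, labelled $0$ and $1$. On an input, an edge labelled $b$ leaving a vertex labelled $z$ is closed if $z=b$. The program accepts iff there is a path of closed edges from start to accept; it computes $f$ if it accepts exactly the inputs with $f=1$. Its size is the number of vertices. The constants hidden in $\Omega$ and $O$ are absolute. -}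

module Defs where

open import Data.Bool using (Bool; true; false; _∧_; _xor_; T)
open import Data.Fin using (Fin)
open import Data.Fin.Subset using (Subset; inside; outside; ∁; ∣_∣)
open import Data.Nat using (ℕ; _+_; _≤_)
open import Data.Product using (∃-syntax; _×_; _,_)
open import Data.Sum using (_⊎_; inj₁; inj₂)
open import Data.Vec using (Vec; []; _∷_; lookup; map; replicate; zipWith; take; drop)
open import Data.Vec.Relation.Unary.All using (All)
open import Function.Bundles using (_⇔_)
open import Level using (0ℓ)
open import Relation.Binary.Construct.Closure.ReflexiveTransitive using (Star)
open import Relation.Binary.Construct.Closure.Transitive using (TransClosure)
open import Relation.Binary.PropositionalEquality using (_≡_)
open import Relation.Nullary using (¬_)
open import Relation.Unary using (Pred; _∩_; _≐_; ｛_｝)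

-- The cube {0,1}^n, with 0 = false and 1 = true.
Cube : ℕ → Set
Cube n = Vec Bool n

-- The 2n = n + n input variables: those of the first argument, then those
-- of the second.
uncut : (n : ℕ) → (Cube n × Cube n → Bool) → Cube (n + n) → Bool
uncut n f z = f (take n z , drop n z)

------------------------------------------------------------------------
-- Linear algebra over 𝔽₂, whose addition is _xor_ and multiplication _∧_

module _ {d : ℕ} where

  0ⱽ : Cube d
  0ⱽ = replicate d false

  infixl 6 _+ⱽ_
  _+ⱽ_ : Cube d → Cube d → Cube d
  _+ⱽ_ = zipWith _xor_

  infixl 7 _·ⱽ_
  _·ⱽ_ : Bool → Cube d → Cube d
  c ·ⱽ v = map (c ∧_) v

  combination : ∀ {k} → Vec Bool k → Vec (Cube d) k → Cube d
  combination []       []       = 0ⱽ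
  combination (c ∷ cs) (v ∷ vs) = c ·ⱽ v +ⱽ combination cs vs

  record IsBasis (W : Pred (Cube d) 0ℓ) {k : ℕ} (bs : Vec (Cube d) k) : Set where
    field
      members     : All W bs
      independent : ∀ cs → combination cs bs ≡ 0ⱽ → cs ≡ replicate k false
      spanning    : ∀ {w} → W w → ∃[ cs ] combination cs bs ≡ w

  -- Meaningful when W is the set of elements of a linear subspace.
  HasDimension : Pred (Cube d) 0ℓ → ℕ → Set
  HasDimension W k = ∃[ bs ] IsBasis W {k} bs

-- The ambient d-dimensional space is 𝔽₂^d.  It is finite, so the
-- Boolean-valued membership test excludes no subspace (classically).
record Subspace (d : ℕ) : Set where
  field
    member : Cube d → Bool

  ⟦_⟧ : Pred (Cube d) 0ℓ
  ⟦_⟧ v = T (member v)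

  field
    0-member : ⟦_⟧ 0ⱽ
    +-closed : ∀ {v w} → ⟦_⟧ v → ⟦_⟧ w → ⟦_⟧ (v +ⱽ w)
    ·-closed : ∀ c {v} → ⟦_⟧ v → ⟦_⟧ (c ·ⱽ v)

open Subspace public using (⟦_⟧)

------------------------------------------------------------------------
-- Bipartite graphs and upd

BipartiteGraph : Set → Set → Set₁
BipartiteGraph U V = U → V → Set

module _ {U V : Set} (_—_ : BipartiteGraph U V) where

  record IsUpdRepresentation {d : ℕ} (φ : U ⊎ V → Subspace d) : Set where
    meet : U → V → Pred (Cube d) 0ℓ
    meet u v = ⟦ φ (inj₁ u) ⟧ ∩ ⟦ φ (inj₂ v) ⟧

    field
      nonzero⇔edge : ∀ u v → (¬ (meet u v ≐ ｛ 0ⱽ ｝)) ⇔ (u — v)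
      dim≤1        : ∀ u v → ∃[ k ] HasDimension (meet u v) k × k ≤ 1

  Representable : ℕ → Set
  Representable d = ∃[ φ ] IsUpdRepresentation {d} φ

  -- "upd = d"
  IsUpd : ℕ → Set
  IsUpd d = Representable d × (∀ d′ → Representable d′ → d ≤ d′)

------------------------------------------------------------------------
-- Partitions of the input variables

-- A subset p of the N variables stands for the partition with first
-- part p and second part ∁ p.
Balanced : (n : ℕ) → Subset (n + n) → Set
Balanced n p = ∣ p ∣ ≡ n × ∣ ∁ p ∣ ≡ n

-- An assignment to a part lists the values of its variables in
-- increasing order of the variables.
combine : ∀ {N} (p : Subset N) → Cube ∣ p ∣ → Cube ∣ ∁ p ∣ → Cube N
combine []            _       _       = []
combine (inside  ∷ p) (a ∷ u) v       = a ∷ combine p u v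
combine (outside ∷ p) u       (b ∷ v) = b ∷ combine p u v

-- For a balanced p, both vertex classes are {0,1}^n.
graph : ∀ {N} → (Cube N → Bool) → (p : Subset N) →
        BipartiteGraph (Cube ∣ p ∣) (Cube ∣ ∁ p ∣)
graph F p u v = F (combine p u v) ≡ true

------------------------------------------------------------------------
-- Deterministic branching programs

data Vertex (k : ℕ) : Set where
  accept reject : Vertex k
  inner         : Fin k → Vertex k

-- target i b is the end of the edge labelled b that leaves inner i.
data Edge {k : ℕ} (target : Fin k → Bool → Vertex k) :
          Vertex k → Vertex k → Set where
  edge : ∀ i b → Edge target (inner i) (target i b)

-- A program over N variables with k vertices besides accept and reject.
-- The start vertex is an inner one because it differs from both.
record BranchingProgram (N : ℕ) : Set where
  field
    k       : ℕ
    start   : Fin k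
    label   : Fin k → Fin N
    target  : Fin k → Bool → Vertex k
    acyclic : ∀ v → ¬ TransClosure (Edge target) v v

  data Closed (x : Cube N) : Vertex k → Vertex k → Set where
    closed : ∀ i b → lookup x (label i) ≡ b → Closed x (inner i) (target i b)

  Accepts : Cube N → Set
  Accepts x = Star (Closed x) (inner start) accept

  size : ℕ
  size = 2 + k

open BranchingProgram public using (Accepts; size)

Computes : ∀ {N} → BranchingProgram N → (Cube N → Bool) → Set
Computes P F = ∀ x → Accepts P x ⇔ (F x ≡ true)

{-# OPTIONS --safe #-}
-- Let S be a set of about 2 ^ n / 8 points of {0,1}^(2n) such that fixing any n
-- coordinates leaves at most 4n + 1 points of S.  It is built greedily, always
-- adding a new point for which the potential Φ, the sum of 2 ^ ∣S ∩ Q∣ over the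
-- subcubes Q of dimension at most n, grows by a factor 1 + O(1 / 2 ^ n); the
-- average over all points of the cube grows no faster.
--
-- For f supported on S, every u has at most 4n + 1 neighbours under every
-- balanced partition.  Send v to the line through a nonzero vector x v and u to
-- the span of the x v over the neighbours v of u: this represents the graph when
-- x v avoids the span belonging to u for all non-neighbours v of u, and counting
-- the vectors to be avoided shows that dimension 6n + 2 leaves room for that.
-- The least dimension then exists because representability can be decided by
-- exhaustive search.
--
-- There are 2 ^ ∣S∣ functions supported on S, more than the branching programs
-- with fewer than 2 ^ n / 48n vertices, so some f is computed by none of these.
module Submission where

open import Defs
open import Data.Bool using (Bool; true; false; T; if_then_else_)
import Data.Bool.Properties as Bool
open import Data.Fin as Fin using (Fin)
import Data.Fin.Properties as Fin
open import Data.Fin.Subset using (Subset; inside; outside; ∁; ∣_∣)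
open import Data.List as List
  using (List; []; _∷_; length; cartesianProduct; allFin; upTo; concatMap)
import Data.List.Membership.DecPropositional as DecMembership
open import Data.List.Membership.Propositional using (_∈_; _∉_; lose)
open import Data.List.Membership.Propositional.Properties
import Data.List.Properties as List
open import Data.List.Relation.Unary.All as All using ([]; _∷_)
import Data.List.Relation.Unary.All.Properties as All
open import Data.List.Relation.Unary.Any as Any using (here; there)
import Data.List.Relation.Unary.Any.Properties as Any
open import Data.List.Relation.Unary.Unique.Propositional using (Unique; []; _∷_)
open import Data.Maybe using (Maybe; just; nothing)
open import Data.Nat
open import Data.Nat.DivMod using (_/_; _%_; m/n*n≤m; m%n≤n; m≡m%n+[m/n]*n)
open import Data.Nat.Induction using (<-rec)
open import Data.Nat.ListAction using (sum)
open import Data.Nat.ListAction.Properties using (sum-++)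
open import Data.Nat.Properties
open import Data.Nat.Tactic.RingSolver using (solve-∀)
open import Data.Product using (Σ-syntax; ∃; ∃-syntax; _×_; _,_; proj₁; proj₂)
open import Data.Sum using (_⊎_; inj₁; inj₂; [_,_]′)
open import Data.Vec as Vec using (Vec; []; _∷_)
import Data.Vec.Properties as Vec
open import Data.Vec.Relation.Unary.All as VecAll using ([]; _∷_)
open import Function using (_∘_; const)
open import Function.Bundles using (mk⇔; Equivalence)
open import Level using (0ℓ)
open import Relation.Binary.Construct.Closure.ReflexiveTransitive using (Star; ε; _◅_)
open import Relation.Binary.Construct.Closure.Transitive using (TransClosure; [_]; _∷ʳ_)
open import Relation.Binary.Definitions using (DecidableEquality)
open import Relation.Binary.PropositionalEquality
open import Relation.Nullary using (¬_; Dec; yes; no; contradiction; ¬?)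
open import Relation.Nullary.Decidable
  using (⌊_⌋; toWitness; fromWitness; map′; _×-dec_; _⊎-dec_; _→-dec_; T?)
open import Relation.Unary using (Pred; Decidable; _≐_; ｛_｝; _∩_)
open import Relation.Unary.Properties using (≐-sym; ≐-trans)

private
  variable
    A B C : Set
    d k n N : ℕ

-- Finite sums and enumerations

∑ : List A → (A → ℕ) → ℕ
∑ xs f = sum (List.map f xs)

syntax ∑ xs (λ x → e) = ∑[ x ∈ xs ] e
infix 5 ∑

∑-cong : ∀ {f g : A → ℕ} xs → (∀ x → f x ≡ g x) → ∑ xs f ≡ ∑ xs g
∑-cong xs f≗g = cong sum (List.map-cong f≗g xs)

∑-mono-≤ : ∀ {f g : A → ℕ} xs → (∀ {x} → x ∈ xs → f x ≤ g x) → ∑ xs f ≤ ∑ xs g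
∑-mono-≤ []       f≤g = z≤n
∑-mono-≤ (x ∷ xs) f≤g = +-mono-≤ (f≤g (here refl)) (∑-mono-≤ xs (f≤g ∘ there))

∑-+ : ∀ (f g : A → ℕ) xs → ∑ xs (λ x → f x + g x) ≡ ∑ xs f + ∑ xs g
∑-+ f g []       = refl
∑-+ f g (x ∷ xs) rewrite ∑-+ f g xs = +-+-interchange (f x) (g x) (∑ xs f) (∑ xs g)
  where
  +-+-interchange : ∀ a b c d → (a + b) + (c + d) ≡ (a + c) + (b + d)
  +-+-interchange = solve-∀

∑-*ʳ : ∀ (f : A → ℕ) c xs → ∑ xs (λ x → f x * c) ≡ ∑ xs f * c
∑-*ʳ f c []       = refl
∑-*ʳ f c (x ∷ xs) rewrite ∑-*ʳ f c xs = sym (*-distribʳ-+ c (f x) (∑ xs f))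

∑-const : ∀ c (xs : List A) → ∑ xs (const c) ≡ length xs * c
∑-const c []       = refl
∑-const c (x ∷ xs) = cong (c +_) (∑-const c xs)

∑-swap : ∀ (f : A → B → ℕ) xs ys →
         ∑[ x ∈ xs ] ∑[ y ∈ ys ] f x y ≡ ∑[ y ∈ ys ] ∑[ x ∈ xs ] f x y
∑-swap f []       ys = sym (trans (∑-const 0 ys) (*-zeroʳ (length ys)))
∑-swap f (x ∷ xs) ys rewrite ∑-swap f xs ys = sym (∑-+ (f x) _ ys)

∑-++ : ∀ (f : A → ℕ) xs ys → ∑ (xs List.++ ys) f ≡ ∑ xs f + ∑ ys f
∑-++ f xs ys = trans (cong sum (List.map-++ f xs ys)) (sum-++ (List.map f xs) _)

∑-map : ∀ (f : B → ℕ) (g : A → B) xs → ∑ (List.map g xs) f ≡ ∑ xs (f ∘ g)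
∑-map f g xs = cong sum (sym (List.map-∘ xs))

∈⇒≤∑ : ∀ (f : A → ℕ) {x xs} → x ∈ xs → f x ≤ ∑ xs f
∈⇒≤∑ f {xs = _ ∷ xs} (here refl)  = m≤m+n _ (∑ xs f)
∈⇒≤∑ f {xs = y ∷ _} (there x∈xs) = ≤-trans (∈⇒≤∑ f x∈xs) (m≤n+m _ (f y))

-- Averaging: if `g x ≤ f x` at the head, cancelling the head keeps the strict inequality for the
-- tail. The points found for the sparse set, for the hard values and for the vectors all come from
-- this.
∑-< : ∀ (f g : A → ℕ) xs → ∑ xs f < ∑ xs g → ∃[ x ] f x < g x
∑-< f g (x ∷ xs) ∑f<∑g with f x <? g x
... | yes fx<gx = x , fx<gx
... | no  fx≮gx = ∑-< f g xs (+-cancelˡ-< (g x) _ _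
                    (≤-<-trans (+-monoˡ-≤ (∑ xs f) (≮⇒≥ fx≮gx)) ∑f<∑g))

length-concatMap : ∀ (f : A → List B) xs → length (List.concatMap f xs) ≡ ∑ xs (length ∘ f)
length-concatMap f []       = refl
length-concatMap f (x ∷ xs) =
  trans (List.length-++ (f x)) (cong (length (f x) +_) (length-concatMap f xs))

length-concatMap-≤ : ∀ (f : A → List B) {c} xs → (∀ x → length (f x) ≤ c) →
                     length (concatMap f xs) ≤ length xs * c
length-concatMap-≤ f {c} xs ≤c = begin
  length (concatMap f xs)  ≡⟨ length-concatMap f xs ⟩
  ∑ xs (length ∘ f)        ≤⟨ ∑-mono-≤ xs (λ {x} _ → ≤c x) ⟩
  ∑ xs (const c)           ≡⟨ ∑-const c xs ⟩
  length xs * c            ∎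
  where open ≤-Reasoning

length-cartesianProductWith : ∀ (f : A → B → C) xs ys →
  length (List.cartesianProductWith f xs ys) ≡ length xs * length ys
length-cartesianProductWith f []       ys = refl
length-cartesianProductWith f (x ∷ xs) ys =
  trans (List.length-++ (List.map (f x) ys))
        (cong₂ _+_ (List.length-map (f x) ys) (length-cartesianProductWith f xs ys))

vectors : List A → ∀ n → List (Vec A n)
vectors xs zero    = [] ∷ []
vectors xs (suc n) = List.cartesianProductWith _∷_ xs (vectors xs n)

∈-vectors : ∀ {xs : List A} → (∀ x → x ∈ xs) → (v : Vec A n) → v ∈ vectors xs n
∈-vectors ∈xs []      = here refl
∈-vectors ∈xs (x ∷ v) = ∈-cartesianProductWith⁺ _∷_ (∈xs x) (∈-vectors ∈xs v)

length-vectors : ∀ (xs : List A) n → length (vectors xs n) ≡ length xs ^ n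
length-vectors xs zero    = refl
length-vectors xs (suc n) =
  trans (length-cartesianProductWith _∷_ xs (vectors xs n))
        (cong (length xs *_) (length-vectors xs n))

bools : List Bool
bools = true ∷ false ∷ []

∈-bools : ∀ b → b ∈ bools
∈-bools true  = here refl
∈-bools false = there (here refl)

cubes : ∀ n → List (Cube n)
cubes = vectors bools

∈-cubes : (x : Cube n) → x ∈ cubes n
∈-cubes = ∈-vectors ∈-bools

_≟ⱽ_ : DecidableEquality (Cube d)
_≟ⱽ_ = Vec.≡-dec Bool._≟_

∑-cubes-suc : ∀ n (f : Cube (suc n) → ℕ) →
              ∑ (cubes (suc n)) f ≡ ∑ (cubes n) (f ∘ (true ∷_)) + ∑ (cubes n) (f ∘ (false ∷_))
∑-cubes-suc n f = begin
  ∑ (List.map (true ∷_) (cubes n) List.++ List.map (false ∷_) (cubes n) List.++ []) f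
    ≡⟨ ∑-++ f (List.map (true ∷_) (cubes n)) _ ⟩
  ∑ (List.map (true ∷_) (cubes n)) f + ∑ (List.map (false ∷_) (cubes n) List.++ []) f
    ≡⟨ cong (λ xs → ∑ (List.map (true ∷_) (cubes n)) f + ∑ xs f)
            (List.++-identityʳ (List.map (false ∷_) (cubes n))) ⟩
  ∑ (List.map (true ∷_) (cubes n)) f + ∑ (List.map (false ∷_) (cubes n)) f
    ≡⟨ cong₂ _+_ (∑-map f _ (cubes n)) (∑-map f _ (cubes n)) ⟩
  ∑ (cubes n) (f ∘ (true ∷_)) + ∑ (cubes n) (f ∘ (false ∷_)) ∎
  where open ≡-Reasoning

-- Subcubes and sparse sets

-- A pattern is a subcube: nothing marks a free coordinate.
Pattern : ℕ → Set
Pattern = Vec (Maybe Bool)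

matches : Pattern N → Cube N → Bool
matches []               []          = true
matches (nothing    ∷ q) (_     ∷ x) = matches q x
matches (just true  ∷ q) (true  ∷ x) = matches q x
matches (just true  ∷ q) (false ∷ x) = false
matches (just false ∷ q) (true  ∷ x) = false
matches (just false ∷ q) (false ∷ x) = matches q x

stars : Pattern N → ℕ
stars []            = 0
stars (nothing ∷ q) = suc (stars q)
stars (just _  ∷ q) = stars q

exactly : Cube N → Pattern N
exactly = Vec.map just

stars-exactly : (x : Cube N) → stars (exactly x) ≡ 0
stars-exactly []      = refl
stars-exactly (_ ∷ x) = stars-exactly x

matches-exactly : (x : Cube N) → matches (exactly x) x ≡ true
matches-exactly []          = refl
matches-exactly (true  ∷ x) = matches-exactly x
matches-exactly (false ∷ x) = matches-exactly x

δ : Bool → ℕ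
δ true  = 1
δ false = 0

-- A free coordinate splits the sum into two equal halves; a fixed coordinate leaves only one half.
∑-matches : (q : Pattern N) → ∑[ x ∈ cubes N ] δ (matches q x) ≡ 2 ^ stars q
∑-matches []                         = refl
∑-matches {suc N} (nothing    ∷ q) = begin
  ∑[ x ∈ cubes (suc N) ] δ (matches (nothing ∷ q) x)
    ≡⟨ ∑-cubes-suc N _ ⟩
  ∑ (cubes N) (δ ∘ matches q) + ∑ (cubes N) (δ ∘ matches q)
    ≡⟨ cong₂ _+_ (∑-matches q) (trans (∑-matches q) (sym (+-identityʳ _))) ⟩
  2 ^ suc (stars q) ∎
  where open ≡-Reasoning
∑-matches {suc N} (just true  ∷ q) = begin
  ∑[ x ∈ cubes (suc N) ] δ (matches (just true ∷ q) x)
    ≡⟨ ∑-cubes-suc N _ ⟩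
  ∑ (cubes N) (δ ∘ matches q) + ∑ (cubes N) (const 0)
    ≡⟨ cong₂ _+_ (∑-matches q) (trans (∑-const 0 (cubes N)) (*-zeroʳ (length (cubes N)))) ⟩
  2 ^ stars q + 0
    ≡⟨ +-identityʳ _ ⟩
  2 ^ stars q ∎
  where open ≡-Reasoning
∑-matches {suc N} (just false ∷ q) = begin
  ∑[ x ∈ cubes (suc N) ] δ (matches (just false ∷ q) x)
    ≡⟨ ∑-cubes-suc N _ ⟩
  ∑ (cubes N) (const 0) + ∑ (cubes N) (δ ∘ matches q)
    ≡⟨ cong₂ _+_ (trans (∑-const 0 (cubes N)) (*-zeroʳ (length (cubes N)))) (∑-matches q) ⟩
  2 ^ stars q ∎
  where open ≡-Reasoning

-- Multiplicity, written through the zero-dimensional subcubes `exactly s` so that `∑-matches`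
-- computes its total over the cube.
occurrences : Cube N → List (Cube N) → ℕ
occurrences x S = ∑[ s ∈ S ] δ (matches (exactly s) x)

∑-occurrences : (S : List (Cube N)) → ∑[ x ∈ cubes N ] occurrences x S ≡ length S
∑-occurrences {N} S = begin
  ∑[ x ∈ cubes N ] ∑[ s ∈ S ] δ (matches (exactly s) x)
    ≡⟨ ∑-swap _ (cubes N) S ⟩
  ∑[ s ∈ S ] ∑[ x ∈ cubes N ] δ (matches (exactly s) x)
    ≡⟨ ∑-cong S (λ s → trans (∑-matches (exactly s)) (cong (2 ^_) (stars-exactly s))) ⟩
  ∑[ s ∈ S ] 1
    ≡⟨ trans (∑-const 1 S) (*-identityʳ _) ⟩
  length S ∎
  where open ≡-Reasoning

occurrences≡0⇒∉ : ∀ {x : Cube N} {S} → occurrences x S ≡ 0 → x ∉ S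
occurrences≡0⇒∉ {x = x} {S} occ≡0 x∈S = contradiction 1≤0 λ ()
  where
  1≤0 : 1 ≤ 0
  1≤0 = subst₂ _≤_ (cong δ (matches-exactly x)) occ≡0
          (∈⇒≤∑ (λ s → δ (matches (exactly s) x)) x∈S)

length-cubes : ∀ n → length (cubes n) ≡ 2 ^ n
length-cubes = length-vectors bools

-- The multiplicities in `xs` add up to `length xs`, so over the `2 ^ N` points their average is
-- below 1 and some point has multiplicity 0.
fresh : (xs : List (Cube N)) → length xs < 2 ^ N → ∃[ x ] x ∉ xs
fresh {N} xs ∣xs∣<2^N =
  let x , occ<1 = ∑-< (λ x → occurrences x xs) (const 1) (cubes N)
                    (subst₂ _<_ (sym (∑-occurrences xs)) (sym ∑1) ∣xs∣<2^N)
  in x , occurrences≡0⇒∉ (n<1⇒n≡0 occ<1)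
  where
  ∑1 : ∑ (cubes N) (const 1) ≡ 2 ^ N
  ∑1 = trans (∑-const 1 (cubes N)) (trans (*-identityʳ _) (length-cubes N))

hits : Pattern N → List (Cube N) → ℕ
hits q S = ∑[ s ∈ S ] δ (matches q s)

-- The potential argument

module Potential {N c : ℕ} (qs : List (Pattern N)) (stars≤c : ∀ {q} → q ∈ qs → stars q ≤ c) where

  Φ : List (Cube N) → ℕ
  Φ S = ∑[ q ∈ qs ] 2 ^ hits q S

  gain : Cube N → List (Cube N) → ℕ
  gain x S = ∑[ q ∈ qs ] δ (matches q x) * 2 ^ hits q S

  -- Adding `x` doubles exactly the terms of the subcubes through `x`.
  Φ-∷ : ∀ x S → Φ (x ∷ S) ≡ Φ S + gain x S
  Φ-∷ x S = trans (∑-cong qs (λ q → 2^δ+ (matches q x) (hits q S))) (∑-+ _ _ qs)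
    where
    2^δ+ : ∀ b h → 2 ^ (δ b + h) ≡ 2 ^ h + δ b * 2 ^ h
    2^δ+ true  h = refl
    2^δ+ false h = sym (+-identityʳ _)

  -- Exchanging the sums, the term of `q` is counted once for each of the `2 ^ stars q` points of
  -- its subcube.
  ∑-gain : ∀ S → ∑[ x ∈ cubes N ] gain x S ≤ 2 ^ c * Φ S
  ∑-gain S = begin
    ∑[ x ∈ cubes N ] ∑[ q ∈ qs ] δ (matches q x) * 2 ^ hits q S
      ≡⟨ ∑-swap _ (cubes N) qs ⟩
    ∑[ q ∈ qs ] ∑[ x ∈ cubes N ] δ (matches q x) * 2 ^ hits q S
      ≡⟨ ∑-cong qs (λ q → trans (∑-*ʳ _ (2 ^ hits q S) (cubes N))
                                (cong (_* 2 ^ hits q S) (∑-matches q))) ⟩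
    ∑[ q ∈ qs ] 2 ^ stars q * 2 ^ hits q S
      ≤⟨ ∑-mono-≤ qs (λ {q} q∈qs → *-monoˡ-≤ (2 ^ hits q S) (^-monoʳ-≤ 2 (stars≤c q∈qs))) ⟩
    ∑[ q ∈ qs ] 2 ^ c * 2 ^ hits q S
      ≡⟨ ∑-cong qs (λ q → *-comm (2 ^ c) _) ⟩
    ∑[ q ∈ qs ] 2 ^ hits q S * 2 ^ c
      ≡⟨ trans (∑-*ʳ _ (2 ^ c) qs) (*-comm (Φ S) _) ⟩
    2 ^ c * Φ S ∎
    where open ≤-Reasoning

  -- The second summand of the averaged quantity exceeds Φ S on S, so the
  -- point found lies outside S.
  extend : ∀ M S → M * 2 ^ c + length S < 2 ^ N → ∃[ x ] (x ∉ S × gain x S * M ≤ Φ S)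
  extend M S room =
    let x , cost<1+Φ = ∑-< cost (const (suc (Φ S))) (cubes N) ∑cost<
    in x , occurrences≡0⇒∉ (occ≡0 _ (≤-<-trans (m≤n+m _ (gain x S * M)) cost<1+Φ))
         , ≤-trans (m≤m+n _ _) (≤-pred cost<1+Φ)
    where
    cost : Cube N → ℕ
    cost x = gain x S * M + occurrences x S * suc (Φ S)

    occ≡0 : ∀ o → o * suc (Φ S) < suc (Φ S) → o ≡ 0
    occ≡0 zero    _  = refl
    occ≡0 (suc o) lt = contradiction lt (≤⇒≯ (m≤m+n (suc (Φ S)) (o * suc (Φ S))))

    rearrange : ∀ a b d l → a * d * b + l * suc d + b * a ≡ (b * a + l) * suc d
    rearrange = solve-∀

    open ≤-Reasoning
    ∑cost< : ∑ (cubes N) cost < ∑ (cubes N) (const (suc (Φ S)))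
    ∑cost< = begin-strict
      ∑ (cubes N) cost
        ≡⟨ ∑-+ _ _ (cubes N) ⟩
      (∑[ x ∈ cubes N ] gain x S * M) + (∑[ x ∈ cubes N ] occurrences x S * suc (Φ S))
        ≡⟨ cong₂ _+_ (∑-*ʳ _ M (cubes N)) (∑-*ʳ _ (suc (Φ S)) (cubes N)) ⟩
      (∑[ x ∈ cubes N ] gain x S) * M + (∑[ x ∈ cubes N ] occurrences x S) * suc (Φ S)
        ≤⟨ +-mono-≤ (*-monoˡ-≤ M (∑-gain S)) (*-monoˡ-≤ (suc (Φ S)) (≤-reflexive (∑-occurrences S))) ⟩
      2 ^ c * Φ S * M + length S * suc (Φ S)
        -- The padding completes `Φ S` to `suc (Φ S)`, which then factors out of the whole bound.
        ≤⟨ m≤m+n _ (M * 2 ^ c) ⟩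
      2 ^ c * Φ S * M + length S * suc (Φ S) + M * 2 ^ c
        ≡⟨ rearrange (2 ^ c) M (Φ S) (length S) ⟩
      (M * 2 ^ c + length S) * suc (Φ S)
        <⟨ *-monoˡ-< (suc (Φ S)) room ⟩
      2 ^ N * suc (Φ S)
        ≡⟨ cong (_* suc (Φ S)) (length-cubes N) ⟨
      length (cubes N) * suc (Φ S)
        ≡⟨ ∑-const _ (cubes N) ⟨
      ∑ (cubes N) (const (suc (Φ S))) ∎

  -- One greedy step: `g ≤ a / M` and `r ≤ M` give `(a + g) * r ≤ a * r + a`. Multiplying by `M`
  -- avoids the fraction.
  shrink : ∀ {M r g} a b → g * M ≤ a → r ≤ M → a * suc r ≤ b → .{{NonZero M}} → (a + g) * r ≤ b
  shrink {M} {r} {g} a b g*M≤a r≤M a*1+r≤b = *-cancelʳ-≤ _ _ M (begin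
    (a + g) * r * M            ≡⟨ rearrange₁ a g r M ⟩
    a * r * M + g * M * r      ≤⟨ +-monoʳ-≤ (a * r * M) (*-mono-≤ g*M≤a r≤M) ⟩
    a * r * M + a * M          ≡⟨ rearrange₂ a r M ⟩
    a * suc r * M              ≤⟨ *-monoˡ-≤ M a*1+r≤b ⟩
    b * M                      ∎)
    where
    open ≤-Reasoning
    rearrange₁ : ∀ a g r M → (a + g) * r * M ≡ a * r * M + g * M * r
    rearrange₁ = solve-∀
    rearrange₂ : ∀ a r M → a * r * M + a * M ≡ a * suc r * M
    rearrange₂ = solve-∀

  -- Each new point multiplies Φ by at most 1 + 1/M, and (1 + 1/M) ^ t ≤ M / r.
  grow : ∀ M t r → t + r ≡ M → M * 2 ^ c + t < 2 ^ N →
         ∃[ S ] (Unique S × length S ≡ t × Φ S * r ≤ length qs * M)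
  grow M zero    r refl _ = [] , [] , refl , ≤-reflexive (cong (_* r) Φ[])
    where
    Φ[] : Φ [] ≡ length qs
    Φ[] = trans (∑-const 1 qs) (*-identityʳ _)
  grow M (suc t) r t+r≡M room =
    let S , uniq , ∣S∣≡t , bound = grow M t (suc r) (trans (+-suc t r) t+r≡M) room′
        x , x∉S , gain≤ = extend M S (subst (λ l → M * 2 ^ c + l < 2 ^ N) (sym ∣S∣≡t) room′)
    in x ∷ S , All.¬Any⇒All¬ S x∉S ∷ uniq , cong suc ∣S∣≡t
     , subst (λ Φ′ → Φ′ * r ≤ length qs * M) (sym (Φ-∷ x S))
         (shrink (Φ S) _ gain≤ (subst (r ≤_) t+r≡M (m≤n+m r (suc t))) bound
            {{>-nonZero (subst (0 <_) t+r≡M z<s)}})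
    where
    room′ : M * 2 ^ c + t < 2 ^ N
    room′ = ≤-<-trans (+-monoʳ-≤ _ (n≤1+n t)) room

trits : List (Maybe Bool)
trits = nothing ∷ just true ∷ just false ∷ []

∈-trits : ∀ t → t ∈ trits
∈-trits nothing      = here refl
∈-trits (just true)  = there (here refl)
∈-trits (just false) = there (there (here refl))

2^-cancel-≤ : ∀ {a b} → 2 ^ a ≤ 2 ^ b → a ≤ b
2^-cancel-≤ {a} {b} le with a ≤? b
... | yes a≤b = a≤b
... | no  a≰b = contradiction le (<⇒≱ (^-monoʳ-< 2 (s≤s (s≤s z≤n)) (≰⇒> a≰b)))

sparseSet : ∀ n m → n ≥ 1 → 8 * m ≤ 2 ^ n →
  ∃[ S ] (Unique S × length S ≡ m ×
          (∀ (q : Pattern (n + n)) → stars q ≤ n → hits q S ≤ 1 + 4 * n))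
sparseSet n m n≥1 8m≤2^n =
  -- With `M = 2m + 1` and `t = m` the remaining `r = m + 1` exceeds `M / 2`, so the potential at
  -- most doubles from its initial value `length qs`. Each single term `2 ^ hits q S` is then at
  -- most `2 ^ (1 + 4 * n)`.
  let S , uniq , ∣S∣≡m , bound = grow (m + suc m) m (suc m) refl room
  in S , uniq , ∣S∣≡m , λ q stars≤n →
       2^-cancel-≤ (≤-trans (∈⇒≤∑ (λ q → 2 ^ hits q S) (∈-filter⁺ few? (∈-vectors ∈-trits q) stars≤n))
                    (Φ≤ (Φ S) bound))
  where
  few? = λ (q : Pattern (n + n)) → stars q ≤? n
  qs = List.filter few? (vectors trits (n + n))
  open Potential {c = n} qs (proj₂ ∘ ∈-filter⁻ few? {xs = vectors trits (n + n)})
  open ≤-Reasoning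

  -- Scaling by 8 lets `8m≤2^n` replace every `m`. The leading term becomes `2 * 2 ^ n * 2 ^ n`, and
  -- the linear terms fit into the remaining six squares because `2 ≤ 2 ^ n`.
  room : (m + suc m) * 2 ^ n + m < 2 ^ (n + n)
  room = *-cancelˡ-< 8 _ _ (begin-strict
    8 * ((m + suc m) * 2 ^ n + m)
      ≡⟨ rearrange₁ m (2 ^ n) ⟩
    2 * (8 * m) * 2 ^ n + 8 * m + 8 * 2 ^ n
      ≤⟨ +-monoˡ-≤ (8 * 2 ^ n) (+-mono-≤ (*-monoˡ-≤ (2 ^ n) (*-monoʳ-≤ 2 8m≤2^n)) 8m≤2^n) ⟩
    2 * 2 ^ n * 2 ^ n + 2 ^ n + 8 * 2 ^ n
      <⟨ m<m+n _ (*-mono-≤ (s≤s (z≤n {2})) 2^n≥1) ⟩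
    2 * 2 ^ n * 2 ^ n + 2 ^ n + 8 * 2 ^ n + 3 * 2 ^ n
      ≡⟨ rearrange₂ (2 ^ n) ⟩
    2 * 2 ^ n * 2 ^ n + (6 * 2 ^ n) * 2
      ≤⟨ +-monoʳ-≤ (2 * 2 ^ n * 2 ^ n) (*-monoʳ-≤ (6 * 2 ^ n) (^-monoʳ-≤ 2 n≥1)) ⟩
    2 * 2 ^ n * 2 ^ n + (6 * 2 ^ n) * 2 ^ n
      ≡⟨ rearrange₃ (2 ^ n) ⟩
    8 * (2 ^ n * 2 ^ n)
      ≡⟨ cong (8 *_) (^-distribˡ-+-* 2 n n) ⟨
    8 * 2 ^ (n + n) ∎)
    where
    2^n≥1 : 1 ≤ 2 ^ n
    2^n≥1 = m^n>0 2 n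
    rearrange₁ : ∀ m X → 8 * ((m + suc m) * X + m) ≡ 2 * (8 * m) * X + 8 * m + 8 * X
    rearrange₁ = solve-∀
    rearrange₂ : ∀ X → 2 * X * X + X + 8 * X + 3 * X ≡ 2 * X * X + (6 * X) * 2
    rearrange₂ = solve-∀
    rearrange₃ : ∀ X → 2 * X * X + (6 * X) * X ≡ 8 * (X * X)
    rearrange₃ = solve-∀

  ∣qs∣≤ : length qs ≤ 2 ^ (4 * n)
  ∣qs∣≤ = begin
    length qs                           ≤⟨ List.length-filter few? (vectors trits (n + n)) ⟩
    length (vectors trits (n + n))      ≡⟨ length-vectors trits (n + n) ⟩
    -- There are three choices per coordinate, rounded up to four to obtain a power of 2.
    3 ^ (n + n)                         ≤⟨ ^-monoˡ-≤ (n + n) (n≤1+n 3) ⟩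
    (2 ^ 2) ^ (n + n)                   ≡⟨ ^-*-assoc 2 2 (n + n) ⟩
    2 ^ (2 * (n + n))                   ≡⟨ cong (2 ^_) (rearrange n) ⟩
    2 ^ (4 * n)                         ∎
    where
    rearrange : ∀ n → 2 * (n + n) ≡ 4 * n
    rearrange = solve-∀

  Φ≤ : ∀ Φ → Φ * suc m ≤ length qs * (m + suc m) → Φ ≤ 2 ^ (1 + 4 * n)
  Φ≤ Φ bound = *-cancelʳ-≤ Φ (2 ^ (1 + 4 * n)) (suc m) (begin
    Φ * suc m                        ≤⟨ bound ⟩
    length qs * (m + suc m)          ≤⟨ *-mono-≤ ∣qs∣≤ (n≤1+n (m + suc m)) ⟩
    2 ^ (4 * n) * (suc m + suc m)    ≡⟨ rearrange (2 ^ (4 * n)) (suc m) ⟩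
    2 ^ (1 + 4 * n) * suc m          ∎)
    where
    rearrange : ∀ a b → a * (b + b) ≡ 2 * a * b
    rearrange = solve-∀

-- Branching programs

Row : ℕ → ℕ → Set
Row N k = Fin N × Vertex k × Vertex k

next : Row N k → Cube N → Vertex k
next (z , v₀ , v₁) x = if Vec.lookup x z then v₁ else v₀

step : (Fin k → Row N k) → Cube N → Vertex k → Vertex k
step rows x accept    = accept
step rows x reject    = reject
step rows x (inner i) = next (rows i) x

run : (Fin k → Row N k) → Cube N → ℕ → Vertex k → Vertex k
run rows x zero    v = v
run rows x (suc t) v = step rows x (run rows x t v)

isAccept : Vertex k → Bool
isAccept accept    = true
isAccept reject    = false
isAccept (inner _) = false

-- Simulation for `k` steps makes sense for every table of rows, acyclic or not, so programs can be
-- counted by counting tables.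
accepts : Vec (Row N k) k → Fin k → Cube N → Bool
accepts {k = k} rows start x = isAccept (run (Vec.lookup rows) x k (inner start))

module _ (P : BranchingProgram N) where
  open BranchingProgram P hiding (Accepts) renaming (k to κ)

  rows : Vec (Row N κ) κ
  rows = Vec.tabulate λ i → label i , target i false , target i true

  module _ (x : Cube N) where

    private
      run′ : ℕ → Vertex κ → Vertex κ
      run′ = run (Vec.lookup rows) x

    step-inner : ∀ i → run′ 1 (inner i) ≡ target i (Vec.lookup x (label i))
    step-inner i = trans (cong (λ row → next row x) (Vec.lookup∘tabulate _ i))
                         (branch (Vec.lookup x (label i)))
      where
      branch : ∀ b → (if b then target i true else target i false) ≡ target i b
      branch true  = refl
      branch false = refl

    -- `run` adds its steps at the end; paths in `Star` grow at the front.
    run-step : ∀ t v → run′ (suc t) v ≡ run′ t (run′ 1 v)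
    run-step zero    v = refl
    run-step (suc t) v = cong (run′ 1) (run-step t v)

    run-accept : ∀ t → run′ t accept ≡ accept
    run-accept zero    = refl
    run-accept (suc t) rewrite run-accept t = refl

    run-+ : ∀ s t v → run′ (s + t) v ≡ run′ s (run′ t v)
    run-+ zero    t v = refl
    run-+ (suc s) t v = cong (run′ 1) (run-+ s t v)

    run-reject : ∀ t → run′ t reject ≡ reject
    run-reject zero    = refl
    run-reject (suc t) rewrite run-reject t = refl

    stays : ∀ {s t u v} → s ≤ t → run′ s u ≡ v → (∀ r → run′ r v ≡ v) → run′ t u ≡ v
    stays {s} {t} {u} s≤t eq fixed = trans (cong (λ r → run′ r u) (sym (m∸n+n≡m s≤t)))
      (trans (run-+ (t ∸ s) s u) (trans (cong (run′ (t ∸ s)) eq) (fixed (t ∸ s))))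

    closed⇒step : ∀ {v w} → Closed x v w → run′ 1 v ≡ w
    closed⇒step (closed i b refl) = step-inner i

    closed*⇒run : ∀ {v w} → Star (Closed x) v w → ∃[ t ] run′ t v ≡ w
    closed*⇒run ε = 0 , refl
    closed*⇒run {v} (e ◅ es) =
      let t , eq = closed*⇒run es
      in suc t , trans (run-step t v) (trans (cong (run′ t) (closed⇒step e)) eq)

    run⇒closed* : ∀ t v → Star (Closed x) v (run′ t v)
    run⇒closed* zero    v         = ε
    run⇒closed* (suc t) accept    = subst (Star _ accept) (sym (run-accept (suc t))) ε
    run⇒closed* (suc t) reject    = subst (Star _ reject) (sym (run-reject (suc t))) ε
    run⇒closed* (suc t) (inner i) =
      subst (Star _ (inner i)) (sym (trans (run-step t _) (cong (run′ t) (step-inner i))))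
        (closed i _ refl ◅ run⇒closed* t _)

    IsInner : Vertex κ → Set
    IsInner v = ∃[ i ] v ≡ inner i

    -- `accept` and `reject` are absorbing, so a run that is at an inner vertex later has not
    -- reached either of them before.
    inner-before : ∀ s t v → IsInner (run′ (s + t) v) → IsInner (run′ t v)
    inner-before s t v isInner with run′ t v | run-+ s t v
    ... | inner i | _  = i , refl
    ... | accept  | eq with () ← trans (sym (proj₂ isInner)) (trans eq (run-accept s))
    ... | reject  | eq with () ← trans (sym (proj₂ isInner)) (trans eq (run-reject s))

    step-edge : ∀ {v} → IsInner v → Edge target v (run′ 1 v)
    step-edge (i , refl) = subst (Edge target (inner i)) (sym (step-inner i)) (edge i _)

    run-path : ∀ s v → (∀ t → t ≤ s → IsInner (run′ t v)) →
               TransClosure (Edge target) v (run′ (suc s) v)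
    run-path zero    v inn = [ step-edge (inn 0 z≤n) ]
    run-path (suc s) v inn = run-path s v (λ t t≤s → inn t (m≤n⇒m≤1+n t≤s))
                               ∷ʳ step-edge (inn (suc s) ≤-refl)

    -- Otherwise the run is at inner vertices at all times from 0 to `κ`. These are `κ + 1` times
    -- for `κ` vertices, so some vertex repeats, and the run between the two visits is a cycle.
    halts : ∀ v → ¬ IsInner (run′ κ v)
    halts v last =
      let i , j , i<j , eq = Fin.pigeonhole (n<1+n κ) (λ t → proj₁ (index (Fin.toℕ t) (Fin.toℕ≤pred[n] t)))
          same : run′ (Fin.toℕ i) v ≡ run′ (Fin.toℕ j) v
          same = trans (proj₂ (index _ (Fin.toℕ≤pred[n] i)))
                   (trans (cong inner eq) (sym (proj₂ (index _ (Fin.toℕ≤pred[n] j)))))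
          -- `run-path s` has `suc s` edges, hence one is subtracted from the gap between the two
          -- visits.
          s = Fin.toℕ j ∸ suc (Fin.toℕ i)
          s+1+i≡j : suc s + Fin.toℕ i ≡ Fin.toℕ j
          s+1+i≡j = trans (sym (+-suc s _)) (m∸n+n≡m i<j)
      in acyclic _ (subst (TransClosure (Edge target) _)
           (trans (sym (run-+ (suc s) (Fin.toℕ i) v)) (trans (cong (λ t → run′ t v) s+1+i≡j) (sym same)))
           (run-path s (run′ (Fin.toℕ i) v) λ t t≤s →
              subst IsInner (run-+ t (Fin.toℕ i) v)
                (index (t + Fin.toℕ i) (≤-trans (+-monoˡ-≤ _ (m≤n⇒m≤1+n t≤s))
                  (≤-trans (≤-reflexive s+1+i≡j) (Fin.toℕ≤pred[n] j))))))
      where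
      index : ∀ t → t ≤ κ → IsInner (run′ t v)
      index t t≤κ = inner-before (κ ∸ t) t v (subst (λ z → IsInner (run′ z v)) (sym (m∸n+n≡m t≤κ)) last)

    accepts⇒Accepts : accepts rows start x ≡ true → Accepts P x
    accepts⇒Accepts eq with run′ κ (inner start) | run⇒closed* κ (inner start)
    ... | accept | path = path

    Accepts⇒accepts : Accepts P x → accepts rows start x ≡ true
    Accepts⇒accepts acc with run′ κ (inner start) in eq
    ... | accept  = refl
    ... | inner i = contradiction (i , eq) (halts (inner start))
    ... | reject with closed*⇒run acc
    -- The run is deterministic and both ends are absorbing: whichever of times `t` and `κ` is
    -- earlier, its end would persist until the other.
    ...   | t , run≡accept with ≤-total t κ
    ...     | inj₁ t≤κ with () ← trans (sym eq) (stays t≤κ run≡accept run-accept)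
    ...     | inj₂ κ≤t with () ← trans (sym run≡accept) (stays κ≤t eq run-reject)

  accepts-computes : ∀ {F} → Computes P F → ∀ x → accepts rows start x ≡ F x
  accepts-computes {F} comp x = Bool.⇔→≡ {z = true} (mk⇔
    (λ acc → Equivalence.to (comp x) (accepts⇒Accepts x acc))
    (λ Fx → Accepts⇒accepts x (Equivalence.from (comp x) Fx)))

-- Counting the outcomes of small programs

vertices : ∀ k → List (Vertex k)
vertices k = accept ∷ reject ∷ List.map inner (allFin k)

∈-vertices : (v : Vertex k) → v ∈ vertices k
∈-vertices accept    = here refl
∈-vertices reject    = there (here refl)
∈-vertices (inner i) = there (there (∈-map⁺ inner (∈-allFin i)))

length-allFin : ∀ n → length (allFin n) ≡ n
length-allFin n = List.length-tabulate {n = n} (λ i → i)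

length-vertices : ∀ k → length (vertices k) ≡ 2 + k
length-vertices k = cong (2 +_) (trans (List.length-map inner (allFin k)) (length-allFin k))

allRows : ∀ N k → List (Row N k)
allRows N k = cartesianProduct (allFin N) (cartesianProduct (vertices k) (vertices k))

∈-allRows : (r : Row N k) → r ∈ allRows N k
∈-allRows (z , v , w) =
  ∈-cartesianProduct⁺ (∈-allFin z) (∈-cartesianProduct⁺ (∈-vertices v) (∈-vertices w))

length-allRows : ∀ N k → length (allRows N k) ≡ N * ((2 + k) * (2 + k))
length-allRows N k = begin
  length (allRows N k)
    ≡⟨ length-cartesianProductWith _,_ (allFin N) _ ⟩
  length (allFin N) * length (cartesianProduct (vertices k) (vertices k))
    ≡⟨ cong₂ _*_ (length-allFin N) (length-cartesianProductWith _,_ (vertices k) (vertices k)) ⟩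
  N * (length (vertices k) * length (vertices k))
    ≡⟨ cong (λ l → N * (l * l)) (length-vertices k) ⟩
  N * ((2 + k) * (2 + k)) ∎
  where open ≡-Reasoning

evaluate : (Cube N → Bool) → (S : List (Cube N)) → Cube (length S)
evaluate F S = Vec.map F (Vec.fromList S)

-- Ranges over all start vertices and all tables, including those with cycles; an upper bound on the
-- number of value vectors is all that is wanted.
outcomes : (S : List (Cube N)) → ℕ → List (Cube (length S))
outcomes {N} S k = List.cartesianProductWith (λ start rows → evaluate (accepts rows start) S)
                     (allFin k) (vectors (allRows N k) k)

length-outcomes : ∀ (S : List (Cube N)) k →
                  length (outcomes S k) ≡ k * (N * ((2 + k) * (2 + k))) ^ k
length-outcomes {N} S k =
  trans (length-cartesianProductWith _ (allFin k) _)
    (cong₂ _*_ (length-allFin k)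
      (trans (length-vectors (allRows N k) k) (cong (_^ k) (length-allRows N k))))

∈-outcomes : ∀ (P : BranchingProgram N) {F} → Computes P F → ∀ S →
             evaluate F S ∈ outcomes S (BranchingProgram.k P)
∈-outcomes P comp S =
  subst (_∈ outcomes S (BranchingProgram.k P)) (Vec.map-cong (accepts-computes P comp) (Vec.fromList S))
    (∈-cartesianProductWith⁺ (λ start rows → evaluate (accepts rows start) S)
      (∈-allFin _) (∈-vectors ∈-allRows (rows P)))

n+n≤2^n : ∀ {n} → n ≥ 1 → n + n ≤ 2 ^ n
n+n≤2^n {suc zero}    _ = ≤-refl
n+n≤2^n {suc (suc n)} _ = begin
  suc (suc n) + suc (suc n)              ≡⟨ rearrange n ⟩
  (suc n + suc n) + 2                    ≤⟨ +-mono-≤ (n+n≤2^n {suc n} z<s) (^-monoʳ-≤ 2 {1} {suc n} z<s) ⟩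
  2 ^ suc n + 2 ^ suc n                  ≡⟨ cong (2 ^ suc n +_) (+-identityʳ _) ⟨
  2 ^ suc (suc n)                        ∎
  where
  open ≤-Reasoning
  rearrange : ∀ n → suc (suc n) + suc (suc n) ≡ (suc n + suc n) + 2
  rearrange = solve-∀

module _ {n : ℕ} (n≥1 : n ≥ 1) (S : List (Cube (n + n))) (large : 2 ^ n ≤ 8 * (1 + length S)) where

  private
    m = length S

    Small : ℕ → Set
    Small k = 48 * (n * (2 + k)) < 2 ^ n

    small? = λ k → 48 * (n * (2 + k)) <? 2 ^ n

    -- The left side is the binary logarithm of the bound in `outcomes-few`. It is at most
    -- `6 * (n * (2 + k))`, and `48 = 8 * 6`, where 8 comes from `large`.
    small-exponent : ∀ {k} → Small k → (n + (n + (n + n)) * k) + (n + 1) ≤ m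
    small-exponent {k} small = begin
      (n + (n + (n + n)) * k) + (n + 1)                ≤⟨ +-monoʳ-≤ (n + (n + (n + n)) * k) (+-monoʳ-≤ n n≥1) ⟩
      (n + (n + (n + n)) * k) + (n + n)                ≤⟨ m≤m+n _ (9 * n + 3 * n * k) ⟩
      (n + (n + (n + n)) * k) + (n + n) + (9 * n + 3 * n * k) ≡⟨ rearrange₁ n k ⟩
      6 * (n * (2 + k))                                ≤⟨ ≤-pred (*-cancelˡ-< 8 _ _ 8*6<) ⟩
      m ∎
      where
      open ≤-Reasoning
      rearrange₁ : ∀ n k → (n + (n + (n + n)) * k) + (n + n) + (9 * n + 3 * n * k) ≡ 6 * (n * (2 + k))
      rearrange₁ = solve-∀
      8*6< : 8 * (6 * (n * (2 + k))) < 8 * (1 + m)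
      8*6< = subst (_< 8 * (1 + m)) (*-assoc 8 6 (n * (2 + k))) (<-≤-trans small large)

    2+k≤2^n : ∀ {k} → Small k → 2 + k ≤ 2 ^ n
    2+k≤2^n {k} small = begin
      2 + k                 ≡⟨ *-identityˡ (2 + k) ⟨
      1 * (2 + k)           ≤⟨ *-monoˡ-≤ (2 + k) n≥1 ⟩
      n * (2 + k)           ≤⟨ m≤n*m (n * (2 + k)) 48 ⟩
      48 * (n * (2 + k))    ≤⟨ <⇒≤ small ⟩
      2 ^ n                 ∎
      where open ≤-Reasoning

    -- The factors `k`, `n + n` and `2 + k` are each at most `2 ^ n`. The spare factor `2 ^ n` pays
    -- for the union over all small `k`, the spare 2 for a strict inequality there.
    outcomes-few : ∀ {k} → Small k → length (outcomes S k) * (2 ^ n * 2) ≤ 2 ^ m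
    outcomes-few {k} small = begin
      length (outcomes S k) * (X * 2)
        ≡⟨ cong (_* (X * 2)) (length-outcomes S k) ⟩
      k * ((n + n) * ((2 + k) * (2 + k))) ^ k * (X * 2)
        ≤⟨ *-monoˡ-≤ (X * 2) (*-mono-≤ (≤-trans (m≤n+m k 2) 2+k≤X)
             (^-monoˡ-≤ k (*-mono-≤ (n+n≤2^n n≥1) (*-mono-≤ 2+k≤X 2+k≤X)))) ⟩
      X * (X * (X * X)) ^ k * (X * 2)
        ≡⟨ cong₂ (λ a b → X * a * b) X³ (sym (^-distribˡ-+-* 2 n 1)) ⟩
      X * 2 ^ ((n + (n + n)) * k) * 2 ^ (n + 1)
        ≡⟨ cong (_* 2 ^ (n + 1)) (^-distribˡ-+-* 2 n _) ⟨
      2 ^ (n + (n + (n + n)) * k) * 2 ^ (n + 1)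
        ≡⟨ ^-distribˡ-+-* 2 (n + (n + (n + n)) * k) (n + 1) ⟨
      2 ^ ((n + (n + (n + n)) * k) + (n + 1))
        ≤⟨ ^-monoʳ-≤ 2 (small-exponent small) ⟩
      2 ^ m ∎
      where
      open ≤-Reasoning
      X = 2 ^ n
      2+k≤X = 2+k≤2^n small
      X³ : (X * (X * X)) ^ k ≡ 2 ^ ((n + (n + n)) * k)
      X³ = trans (cong (_^ k) (sym (trans (^-distribˡ-+-* 2 n (n + n)) (cong (X *_) (^-distribˡ-+-* 2 n n)))))
                 (^-*-assoc 2 (n + (n + n)) k)

    smallSizes : List ℕ
    -- `Small k` forces `2 + k ≤ 2 ^ n`, so no small `k` lies outside this range.
    smallSizes = List.filter small? (upTo (2 ^ n))

    smallOutcomes : List (Cube m)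
    smallOutcomes = concatMap (outcomes S) smallSizes

    smallOutcomes-few : length smallOutcomes < 2 ^ m
    smallOutcomes-few = half< (*-cancelˡ-≤ X {{m^n≢0 2 n}} (begin
      X * (length smallOutcomes * 2)
        ≡⟨ rearrange X (length smallOutcomes) ⟩
      length smallOutcomes * (X * 2)
        ≡⟨ cong (_* (X * 2)) (length-concatMap (outcomes S) smallSizes) ⟩
      (∑[ k ∈ smallSizes ] length (outcomes S k)) * (X * 2)
        ≡⟨ ∑-*ʳ _ (X * 2) smallSizes ⟨
      (∑[ k ∈ smallSizes ] length (outcomes S k) * (X * 2))
        ≤⟨ ∑-mono-≤ smallSizes (λ k∈ → outcomes-few (proj₂ (∈-filter⁻ small? {xs = upTo X} k∈))) ⟩
      (∑[ k ∈ smallSizes ] 2 ^ m)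
        ≡⟨ ∑-const _ smallSizes ⟩
      length smallSizes * 2 ^ m
        ≤⟨ *-monoˡ-≤ (2 ^ m) (≤-trans (List.length-filter small? (upTo X)) (≤-reflexive (List.length-upTo X))) ⟩
      X * 2 ^ m ∎))
      where
      open ≤-Reasoning
      X = 2 ^ n
      rearrange : ∀ X l → X * (l * 2) ≡ l * (X * 2)
      rearrange = solve-∀
      half< : ∀ {l} → l * 2 ≤ 2 ^ m → l < 2 ^ m
      half< {zero}  _  = m^n>0 2 m
      half< {suc l} le = <-≤-trans (m<m*n (suc l) 2 (s≤s (s≤s z≤n))) le

  -- Take for `A` a value vector on `S` that no small table produces. Any `F` with these values on
  -- `S` is hard, whatever it does elsewhere.
  hardValues : ∃[ A ] ((P : BranchingProgram (n + n)) → ∀ {F} → Computes P F →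
                       evaluate F S ≡ A → 2 ^ n ≤ 48 * (n * size P))
  hardValues =
    let A , A∉ = fresh smallOutcomes smallOutcomes-few
    in A , λ P {F} comp F≡A → ≮⇒≥ λ small → A∉
         (∈-concatMap⁺ (outcomes S) (Any.map
           (λ { refl → subst (_∈ outcomes S (BranchingProgram.k P)) F≡A (∈-outcomes P comp S) })
           (∈-filter⁺ small? (∈-upTo⁺ (<-≤-trans (m<n+m _ z<s) (2+k≤2^n small))) small)))

-- Functions supported on a list of points

select : (S : List (Cube N)) → Cube (length S) → Cube N → Bool
select []      []      z = false
select (s ∷ S) (a ∷ A) z with s ≟ⱽ z
... | yes _ = a
... | no  _ = select S A z

select⇒∈ : ∀ (S : List (Cube N)) A {z} → select S A z ≡ true → z ∈ S
select⇒∈ []      []      ()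
select⇒∈ (s ∷ S) (a ∷ A) {z} eq with s ≟ⱽ z
... | yes refl = here refl
... | no  _    = there (select⇒∈ S A eq)

select-here : ∀ s (S : List (Cube N)) a A → select (s ∷ S) (a ∷ A) s ≡ a
select-here s S a A with s ≟ⱽ s
... | yes _   = refl
... | no  s≢s = contradiction refl s≢s

select-there : ∀ {s} (S : List (Cube N)) a A {z} → s ≢ z → select (s ∷ S) (a ∷ A) z ≡ select S A z
select-there {s = s} S a A {z} s≢z with s ≟ⱽ z
... | yes s≡z = contradiction s≡z s≢z
... | no  _   = refl

evaluate-cong : ∀ {F G : Cube N → Bool} {S} → All.All (λ s → F s ≡ G s) S → evaluate F S ≡ evaluate G S
evaluate-cong []         = refl
evaluate-cong (eq ∷ eqs) = cong₂ _∷_ eq (evaluate-cong eqs)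

-- `select` uses the first match only; uniqueness keeps the head from shadowing a later entry.
evaluate-select : ∀ {S : List (Cube N)} → Unique S → ∀ A → evaluate (select S A) S ≡ A
evaluate-select []           []      = refl
evaluate-select {S = s ∷ S} (s∉S ∷ uniq) (a ∷ A) =
  cong₂ _∷_ (select-here s S a A)
    (trans (evaluate-cong (All.map (select-there S a A) s∉S)) (evaluate-select uniq A))

-- Subspaces in general position

+ⱽ-assoc : (u v w : Cube d) → (u +ⱽ v) +ⱽ w ≡ u +ⱽ (v +ⱽ w)
+ⱽ-assoc = Vec.zipWith-assoc Bool.xor-assoc

+ⱽ-comm : (u v : Cube d) → u +ⱽ v ≡ v +ⱽ u
+ⱽ-comm = Vec.zipWith-comm Bool.xor-comm

+ⱽ-identityˡ : (v : Cube d) → 0ⱽ +ⱽ v ≡ v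
+ⱽ-identityˡ = Vec.zipWith-identityˡ Bool.xor-identityˡ

+ⱽ-identityʳ : (v : Cube d) → v +ⱽ 0ⱽ ≡ v
+ⱽ-identityʳ = Vec.zipWith-identityʳ Bool.xor-identityʳ

+ⱽ-self : (v : Cube d) → v +ⱽ v ≡ 0ⱽ
+ⱽ-self []      = refl
+ⱽ-self (b ∷ v) = cong₂ _∷_ (Bool.xor-same b) (+ⱽ-self v)

+ⱽ-cancelˡ : (u v : Cube d) → u +ⱽ (u +ⱽ v) ≡ v
+ⱽ-cancelˡ u v = trans (sym (+ⱽ-assoc u u v)) (trans (cong (_+ⱽ v) (+ⱽ-self u)) (+ⱽ-identityˡ v))

+ⱽ-swap : (u v w : Cube d) → u +ⱽ (v +ⱽ w) ≡ v +ⱽ (u +ⱽ w)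
+ⱽ-swap u v w = trans (sym (+ⱽ-assoc u v w)) (trans (cong (_+ⱽ w) (+ⱽ-comm u v)) (+ⱽ-assoc v u w))

·ⱽ-zero : (v : Cube d) → false ·ⱽ v ≡ 0ⱽ
·ⱽ-zero []      = refl
·ⱽ-zero (_ ∷ v) = cong (false ∷_) (·ⱽ-zero v)

·ⱽ-identity : (v : Cube d) → true ·ⱽ v ≡ v
·ⱽ-identity = Vec.map-id

-- The sums of all sublists, with repetitions when the vectors are dependent, so that the length is
-- a power of 2 in every case.
span : List (Cube d) → List (Cube d)
span []       = 0ⱽ ∷ []
span (v ∷ vs) = span vs List.++ List.map (v +ⱽ_) (span vs)

length-span : (vs : List (Cube d)) → length (span vs) ≡ 2 ^ length vs
length-span []       = refl
length-span (v ∷ vs) = begin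
  length (span vs List.++ List.map (v +ⱽ_) (span vs))          ≡⟨ List.length-++ (span vs) ⟩
  length (span vs) + length (List.map (v +ⱽ_) (span vs))
    ≡⟨ cong (length (span vs) +_) (List.length-map _ (span vs)) ⟩
  length (span vs) + length (span vs)
    ≡⟨ cong₂ _+_ (length-span vs) (trans (length-span vs) (sym (+-identityʳ _))) ⟩
  2 ^ length (v ∷ vs)                                          ∎
  where open ≡-Reasoning

span-weaken : ∀ (v : Cube d) vs {z} → z ∈ span vs → z ∈ span (v ∷ vs)
span-weaken v vs = ∈-++⁺ˡ

span-add : ∀ (v : Cube d) vs {z} → z ∈ span vs → v +ⱽ z ∈ span (v ∷ vs)
span-add v vs z∈ = ∈-++⁺ʳ (span vs) (∈-map⁺ (v +ⱽ_) z∈)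

span-∷⁻ : ∀ (v : Cube d) vs {z} → z ∈ span (v ∷ vs) →
          z ∈ span vs ⊎ ∃[ s ] (s ∈ span vs × z ≡ v +ⱽ s)
span-∷⁻ v vs z∈ with ∈-++⁻ (span vs) z∈
... | inj₁ z∈span = inj₁ z∈span
... | inj₂ z∈map  = inj₂ (∈-map⁻ (v +ⱽ_) z∈map)

0∈span : (vs : List (Cube d)) → 0ⱽ ∈ span vs
0∈span []       = here refl
0∈span (v ∷ vs) = span-weaken v vs (0∈span vs)

∈⇒∈span : ∀ {v : Cube d} vs → v ∈ vs → v ∈ span vs
∈⇒∈span (v ∷ vs) (here refl) =
  subst (_∈ span (v ∷ vs)) (+ⱽ-identityʳ v) (span-add v vs (0∈span vs))
∈⇒∈span (v ∷ vs) (there v∈vs) = span-weaken v vs (∈⇒∈span vs v∈vs)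

span-+ : ∀ (vs : List (Cube d)) {y z} → y ∈ span vs → z ∈ span vs → y +ⱽ z ∈ span vs
span-+ []       (here refl) (here refl) = here (+ⱽ-self 0ⱽ)
span-+ (v ∷ vs) y∈ z∈ with span-∷⁻ v vs y∈ | span-∷⁻ v vs z∈
... | inj₁ y∈span | inj₁ z∈span = span-weaken v vs (span-+ vs y∈span z∈span)
... | inj₁ y∈span | inj₂ (t , t∈span , refl) =
  subst (_∈ span (v ∷ vs)) (+ⱽ-swap v _ t) (span-add v vs (span-+ vs y∈span t∈span))
... | inj₂ (s , s∈span , refl) | inj₁ z∈span =
  subst (_∈ span (v ∷ vs)) (sym (+ⱽ-assoc v s _)) (span-add v vs (span-+ vs s∈span z∈span))
... | inj₂ (s , s∈span , refl) | inj₂ (t , t∈span , refl) =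
  subst (_∈ span (v ∷ vs))
    (sym (trans (+ⱽ-assoc v s (v +ⱽ t)) (trans (cong (v +ⱽ_) (+ⱽ-swap s v t)) (+ⱽ-cancelˡ v (s +ⱽ t)))))
    (span-weaken v vs (span-+ vs s∈span t∈span))

module _ {d : ℕ} where
  open DecMembership (_≟ⱽ_ {d}) using (_∈?_) public

spanSubspace : List (Cube d) → Subspace d
spanSubspace vs = record
  { member   = λ y → ⌊ y ∈? span vs ⌋
  ; 0-member = fromWitness (0∈span vs)
  ; +-closed = λ v∈ w∈ → fromWitness (span-+ vs (toWitness v∈) (toWitness w∈))
  ; ·-closed = λ { false {v} v∈ → fromWitness (subst (_∈ span vs) (sym (·ⱽ-zero v)) (0∈span vs))
                 ; true  {v} v∈ → fromWitness (subst (_∈ span vs) (sym (·ⱽ-identity v)) (toWitness v∈)) }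
  }

∈span-singleton : ∀ {v z : Cube d} → z ∈ span (v ∷ []) → z ≡ 0ⱽ ⊎ z ≡ v
∈span-singleton (here refl)         = inj₁ refl
∈span-singleton (there (here refl)) = inj₂ (+ⱽ-identityʳ _)

zero-dimensional : ∀ {W : Pred (Cube d) 0ℓ} → W ≐ ｛ 0ⱽ ｝ → HasDimension W 0
zero-dimensional (W⊆0 , _) = [] , record
  { members     = []
  ; independent = λ { [] _ → refl }
  ; spanning    = λ w∈W → [] , W⊆0 w∈W
  }

one-dimensional : ∀ {W : Pred (Cube d) 0ℓ} {b} → W b → b ≢ 0ⱽ → (∀ {w} → W w → w ≡ 0ⱽ ⊎ w ≡ b) →
                  HasDimension W 1
one-dimensional {W = W} {b} b∈W b≢0 W⊆ = b ∷ [] , record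
  { members     = b∈W ∷ []
  ; independent = λ { (false ∷ []) _  → refl
                    ; (true  ∷ []) eq → contradiction (trans (sym (1·b≡b)) eq) b≢0 }
  ; spanning    = λ w∈W → spans (W⊆ w∈W)
  }
  where
  1·b≡b : true ·ⱽ b +ⱽ 0ⱽ ≡ b
  1·b≡b = trans (+ⱽ-identityʳ _) (·ⱽ-identity b)
  spans : ∀ {w} → w ≡ 0ⱽ ⊎ w ≡ b → ∃[ cs ] combination cs (b ∷ []) ≡ w
  spans (inj₁ refl) = false ∷ [] , trans (+ⱽ-identityʳ _) (·ⱽ-zero b)
  spans (inj₂ refl) = true ∷ [] , 1·b≡b

module _ {V : Set} (_≟_ : DecidableEquality V) where

  update : (V → A) → V → A → V → A
  update x v y w with w ≟ v
  ... | yes _ = y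
  ... | no  _ = x w

  update-same : ∀ (x : V → A) v y → update x v y v ≡ y
  update-same x v y with v ≟ v
  ... | yes _   = refl
  ... | no  v≢v = contradiction refl v≢v

  update-other : ∀ (x : V → A) {v w} y → w ≢ v → update x v y w ≡ x w
  update-other x {v} {w} y w≢v with w ≟ v
  ... | yes w≡v = contradiction w≡v w≢v
  ... | no  _   = refl

  -- In a sum of updated vectors the copies of `y` cancel in pairs. An even number leaves a sum of
  -- old vectors, an odd number leaves `y` plus such a sum; `l` may list `v` repeatedly.
  span-update : ∀ (x : V → Cube d) v y l {z} → z ∈ span (List.map (update x v y) l) →
                z ∈ span (List.map x l) ⊎
                (v ∈ l × ∃[ s ] (s ∈ span (List.map x l) × z ≡ y +ⱽ s))
  span-update x v y []      z∈ = inj₁ z∈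
  span-update x v y (a ∷ l) z∈ with span-∷⁻ (update x v y a) (List.map (update x v y) l) z∈
  span-update x v y (a ∷ l) z∈ | inj₁ z∈′ with span-update x v y l z∈′
  ... | inj₁ z∈span             = inj₁ (span-weaken (x a) (List.map x l) z∈span)
  ... | inj₂ (v∈l , s , s∈ , eq) = inj₂ (there v∈l , s , span-weaken (x a) (List.map x l) s∈ , eq)
  span-update x v y (a ∷ l) z∈ | inj₂ (z′ , z′∈ , refl) with span-update x v y l z′∈ | a ≟ v
  ... | inj₁ z′∈span | yes refl =
    inj₂ (here refl , z′ , span-weaken (x a) (List.map x l) z′∈span , refl)
  ... | inj₁ z′∈span | no _ = inj₁ (span-add (x a) (List.map x l) z′∈span)
  ... | inj₂ (v∈l , s , s∈ , refl) | yes refl =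
    inj₁ (subst (_∈ span (List.map x (a ∷ l))) (sym (+ⱽ-cancelˡ y s))
      (span-weaken (x a) (List.map x l) s∈))
  ... | inj₂ (v∈l , s , s∈ , refl) | no _ =
    inj₂ (there v∈l , x a +ⱽ s , span-add (x a) (List.map x l) s∈ , +ⱽ-swap (x a) y s)

-- Greedy choice of vectors avoiding spans

module GeneralPosition
  {U V : Set} (_≟_ : DecidableEquality V) (u₀ : U)
  {us : List U} (∈us : ∀ u → u ∈ us) {vs : List V} (∈vs : ∀ v → v ∈ vs)
  (nbr : U → List V) {D d : ℕ} (degree : ∀ u → length (nbr u) ≤ D)
  (room : length us * length vs * 2 ^ D < 2 ^ d)
  where

  open DecMembership _≟_ using () renaming (_∈?_ to _∈V?_)

  spanNbr : (V → Cube d) → U → List (Cube d)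
  spanNbr x u = span (List.map x (nbr u))

  -- Vertices not yet treated carry the vector 0.
  record Partial (ws : List V) (x : V → Cube d) : Set where
    field
      untreated   : ∀ {w} → w ∉ ws → x w ≡ 0ⱽ
      nonzero     : ∀ {w} → w ∈ ws → x w ≢ 0ⱽ
      independent : ∀ u {w} → w ∈ ws → w ∉ nbr u → x w ∉ spanNbr x u
  open Partial

  -- If `v` is a neighbour of `u`, giving `y` to `v` enlarges the span of `u` by `y +ⱽ s`. This
  -- captures `x w` exactly when `y` is `x w +ⱽ s` for some `s` in the old span.
  forbidden : (V → Cube d) → List (Cube d)
  forbidden x = concatMap (λ (u , w) → List.map (x w +ⱽ_) (spanNbr x u)) (cartesianProduct us vs)

  forbidden-few : ∀ x → length (forbidden x) < 2 ^ d
  forbidden-few x = begin-strict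
    length (forbidden x)
      ≤⟨ length-concatMap-≤ _ (cartesianProduct us vs) (λ (u , w) → bound u w) ⟩
    length (cartesianProduct us vs) * 2 ^ D
      ≡⟨ cong (_* 2 ^ D) (length-cartesianProductWith _,_ us vs) ⟩
    length us * length vs * 2 ^ D
      <⟨ room ⟩
    2 ^ d ∎
    where
    open ≤-Reasoning
    bound : ∀ u w → length (List.map (x w +ⱽ_) (spanNbr x u)) ≤ 2 ^ D
    bound u w = begin
      length (List.map (x w +ⱽ_) (spanNbr x u))  ≡⟨ List.length-map _ (spanNbr x u) ⟩
      length (spanNbr x u)                       ≡⟨ length-span (List.map x (nbr u)) ⟩
      2 ^ length (List.map x (nbr u))            ≡⟨ cong (2 ^_) (List.length-map x (nbr u)) ⟩
      2 ^ length (nbr u)                         ≤⟨ ^-monoʳ-≤ 2 (degree u) ⟩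
      2 ^ D                                      ∎

  extend : ∀ {ws x v} → v ∉ ws → Partial ws x → ∃[ x′ ] Partial (v ∷ ws) x′
  extend {ws} {x} {v} v∉ws good with fresh (forbidden x) (forbidden-few x)
  ... | y , y∉ = x′ , record
    { untreated   = λ w∉ → trans (update-other _≟_ x y (w∉ ∘ here)) (untreated good (w∉ ∘ there))
    ; nonzero     = λ {w} w∈ x′w≡0 → nonzero′ w∈ (w ≟ v) x′w≡0
    ; independent = λ u {w} w∈ w∉nbr x′w∈ →
        independent′ u w∈ (w ≟ v) w∉nbr (span-update _≟_ x v y (nbr u) x′w∈)
    }
    where
    x′ = update _≟_ x v y

    y≢ : ∀ u w {s} → s ∈ spanNbr x u → y ≢ x w +ⱽ s
    y≢ u w s∈ refl = y∉ (∈-concatMap⁺ _ (lose (∈-cartesianProduct⁺ (∈us u) (∈vs w)) (∈-map⁺ (x w +ⱽ_) s∈)))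

    -- As `v` is untreated, `x v` is 0, so the spans themselves are among the forbidden translates.
    y∉span : ∀ u → y ∉ spanNbr x u
    y∉span u y∈ = y≢ u v y∈ (sym (trans (cong (_+ⱽ y) (untreated good v∉ws)) (+ⱽ-identityˡ y)))

    older : ∀ {w} → w ∈ v ∷ ws → w ≢ v → w ∈ ws
    older (here w≡v)   w≢v = contradiction w≡v w≢v
    older (there w∈ws) _   = w∈ws

    nonzero′ : ∀ {w} → w ∈ v ∷ ws → Dec (w ≡ v) → x′ w ≢ 0ⱽ
    -- 0 lies in every span, so avoiding the span of the one vertex `u₀` makes `y` nonzero.
    nonzero′ _ (yes refl) x′v≡0 =
      y∉span u₀ (subst (_∈ spanNbr x u₀) (trans (sym x′v≡0) (update-same _≟_ x v y))
        (0∈span (List.map x (nbr u₀))))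
    nonzero′ w∈ (no w≢v) x′w≡0 =
      nonzero good (older w∈ w≢v) (trans (sym (update-other _≟_ x y w≢v)) x′w≡0)

    independent′ : ∀ u {w} → w ∈ v ∷ ws → Dec (w ≡ v) → w ∉ nbr u →
      ¬ (x′ w ∈ spanNbr x u ⊎ (v ∈ nbr u × ∃[ s ] (s ∈ spanNbr x u × x′ w ≡ y +ⱽ s)))
    independent′ u _ (yes refl) _ (inj₁ y∈) = y∉span u (subst (_∈ spanNbr x u) (update-same _≟_ x v y) y∈)
    independent′ u _ (yes refl) v∉nbr (inj₂ (v∈nbr , _)) = v∉nbr v∈nbr
    independent′ u w∈ (no w≢v) w∉nbr (inj₁ x′w∈) =
      independent good u (older w∈ w≢v) w∉nbr (subst (_∈ spanNbr x u) (update-other _≟_ x y w≢v) x′w∈)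
    -- Over `𝔽₂`, `x w ≡ y +ⱽ s` can be solved for `y`, giving a forbidden vector.
    independent′ u {w} w∈ (no w≢v) w∉nbr (inj₂ (_ , s , s∈ , x′w≡y+s)) = y≢ u w s∈ (begin
      y                  ≡⟨ +ⱽ-cancelˡ s y ⟨
      s +ⱽ (s +ⱽ y)      ≡⟨ +ⱽ-comm s _ ⟩
      s +ⱽ y +ⱽ s        ≡⟨ cong (_+ⱽ s) (+ⱽ-comm s y) ⟩
      y +ⱽ s +ⱽ s        ≡⟨ cong (_+ⱽ s) (trans (sym x′w≡y+s) (update-other _≟_ x y w≢v)) ⟩
      x w +ⱽ s           ∎)
      where open ≡-Reasoning

  partials : ∀ ws → ∃[ x ] Partial ws x
  partials [] = const 0ⱽ , record
    { untreated   = λ _ → refl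
    ; nonzero     = λ ()
    ; independent = λ _ ()
    }
  partials (v ∷ ws) with partials ws | v ∈V? ws
  ... | x , good | no  v∉ws = extend v∉ws good
  -- A vertex listed again keeps the vector it already has.
  ... | x , good | yes v∈ws = x , record
    { untreated   = λ w∉ → untreated good (w∉ ∘ there)
    ; nonzero     = nonzero good ∘ drop
    ; independent = λ u → independent good u ∘ drop
    }
    where
    drop : ∀ {w} → w ∈ v ∷ ws → w ∈ ws
    drop (here refl)  = v∈ws
    drop (there w∈ws) = w∈ws

  x : V → Cube d
  x = proj₁ (partials vs)

  x≢0 : ∀ v → x v ≢ 0ⱽ
  x≢0 v = nonzero (proj₂ (partials vs)) (∈vs v)

  x∉span : ∀ u {v} → v ∉ nbr u → x v ∉ spanNbr x u
  x∉span u {v} = independent (proj₂ (partials vs)) u (∈vs v)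

  -- The only elements of the line of `v` are 0 and `x v`, so the intersection is decided by whether
  -- `x v` lies in the span of `u`: always for neighbours, never for others by `x∉span`.
  representable : {_—_ : BipartiteGraph U V} →
                  (∀ {u v} → v ∈ nbr u → u — v) → (∀ {u v} → u — v → v ∈ nbr u) →
                  Representable _—_ d
  representable {_—_} sound complete = φ , record
    { nonzero⇔edge = λ u v → mk⇔ (nonzero⇒edge u v) (edge⇒nonzero u v)
    ; dim≤1        = dim≤1′
    }
    where
    φ : U ⊎ V → Subspace d
    φ (inj₁ u) = spanSubspace (List.map x (nbr u))
    φ (inj₂ v) = spanSubspace (x v ∷ [])

    Meet : U → V → Pred (Cube d) 0ℓ
    Meet u v = ⟦ φ (inj₁ u) ⟧ ∩ ⟦ φ (inj₂ v) ⟧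

    on-line : ∀ {u v w} → Meet u v w → w ≡ 0ⱽ ⊎ w ≡ x v
    on-line (_ , w∈line) = ∈span-singleton (toWitness w∈line)

    trivial : ∀ {u v} → v ∉ nbr u → Meet u v ≐ ｛ 0ⱽ ｝
    trivial {u} {v} v∉ = ⊆0 , λ { refl → Subspace.0-member (φ (inj₁ u)) , Subspace.0-member (φ (inj₂ v)) }
      where
      ⊆0 : ∀ {w} → Meet u v w → 0ⱽ ≡ w
      ⊆0 meet with on-line {u} {v} meet
      ... | inj₁ w≡0  = sym w≡0
      ... | inj₂ refl = contradiction (toWitness (proj₁ meet)) (x∉span u v∉)

    common : ∀ {u v} → v ∈ nbr u → Meet u v (x v)
    common v∈ = fromWitness (∈⇒∈span (List.map x (nbr _)) (∈-map⁺ x v∈))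
             , fromWitness (∈⇒∈span (x _ ∷ []) (here refl))

    nonzero⇒edge : ∀ u v → ¬ (Meet u v ≐ ｛ 0ⱽ ｝) → u — v
    nonzero⇒edge u v nz with v ∈V? nbr u
    ... | yes v∈ = sound v∈
    ... | no  v∉ = contradiction (trivial v∉) nz

    edge⇒nonzero : ∀ u v → u — v → ¬ (Meet u v ≐ ｛ 0ⱽ ｝)
    edge⇒nonzero u v e (⊆0 , _) = x≢0 v (sym (⊆0 (common (complete e))))

    dim≤1′ : ∀ u v → ∃[ k ] HasDimension (Meet u v) k × k ≤ 1
    dim≤1′ u v with v ∈V? nbr u
    ... | yes v∈ = 1 , one-dimensional (common v∈) (x≢0 v) (on-line {u} {v}) , ≤-refl
    ... | no  v∉ = 0 , zero-dimensional (trivial v∉) , z≤n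

-- Graphs of sparsely supported functions

fixing : (p : Subset N) → Cube ∣ p ∣ → Pattern N
fixing []            _       = []
fixing (inside  ∷ p) (a ∷ u) = just a ∷ fixing p u
fixing (outside ∷ p) u       = nothing ∷ fixing p u

restrict : (p : Subset N) → Cube N → Cube ∣ ∁ p ∣
restrict []            []      = []
restrict (inside  ∷ p) (_ ∷ z) = restrict p z
restrict (outside ∷ p) (b ∷ z) = b ∷ restrict p z

-- `fixing p u` is the subcube of all `combine p u v`; its free coordinates are the variables of the
-- second part.
stars-fixing : (p : Subset N) (u : Cube ∣ p ∣) → stars (fixing p u) ≡ ∣ ∁ p ∣
stars-fixing []            _       = refl
stars-fixing (inside  ∷ p) (a ∷ u) = stars-fixing p u
stars-fixing (outside ∷ p) u       = cong suc (stars-fixing p u)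

restrict-combine : ∀ (p : Subset N) u v → restrict p (combine p u v) ≡ v
restrict-combine []            _       []      = refl
restrict-combine (inside  ∷ p) (_ ∷ u) v       = restrict-combine p u v
restrict-combine (outside ∷ p) u       (b ∷ v) = cong (b ∷_) (restrict-combine p u v)

matches-combine : ∀ (p : Subset N) u v → matches (fixing p u) (combine p u v) ≡ true
matches-combine []            _           _       = refl
matches-combine (inside  ∷ p) (true  ∷ u) v       = matches-combine p u v
matches-combine (inside  ∷ p) (false ∷ u) v       = matches-combine p u v
matches-combine (outside ∷ p) u           (_ ∷ v) = matches-combine p u v

combine-restrict : ∀ (p : Subset N) u z → matches (fixing p u) z ≡ true →
                   combine p u (restrict p z) ≡ z
combine-restrict []            _           []          _  = refl
combine-restrict (inside  ∷ p) (true  ∷ u) (true  ∷ z) eq = cong (true ∷_) (combine-restrict p u z eq)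
combine-restrict (inside  ∷ p) (false ∷ u) (false ∷ z) eq = cong (false ∷_) (combine-restrict p u z eq)
combine-restrict (outside ∷ p) u           (b ∷ z)     eq = cong (b ∷_) (combine-restrict p u z eq)

length-filter-≤ : ∀ {P : Pred A 0ℓ} (P? : Decidable P) {b : A → Bool} → (∀ {x} → P x → b x ≡ true) →
                  ∀ xs → length (List.filter P? xs) ≤ ∑ xs (δ ∘ b)
length-filter-≤ P? P⇒b []       = z≤n
length-filter-≤ P? {b} P⇒b (x ∷ xs) with P? x
... | yes px rewrite P⇒b px = s≤s (length-filter-≤ P? P⇒b xs)
... | no  _  = ≤-trans (length-filter-≤ P? P⇒b xs) (m≤n+m _ (δ (b x)))

-- The neighbours of `u` come from the points of `S` in the subcube `fixing p u`, so `hits` bounds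
-- the degree and the greedy choice applies.
sparse⇒representable :
  ∀ {F : Cube N → Bool} {S} → (∀ {z} → F z ≡ true → z ∈ S) →
  ∀ (p : Subset N) {D d} → (∀ u → hits (fixing p u) S ≤ D) →
  2 ^ ∣ p ∣ * 2 ^ ∣ ∁ p ∣ * 2 ^ D < 2 ^ d →
  Representable (graph F p) d
sparse⇒representable {F = F} {S} support p {D} {d} hits≤D room =
  GeneralPosition.representable _≟ⱽ_ 0ⱽ ∈-cubes ∈-cubes nbr degree
    (subst₂ (λ a b → a * b * 2 ^ D < 2 ^ d) (sym (length-cubes ∣ p ∣)) (sym (length-cubes ∣ ∁ p ∣)) room)
    sound complete
  where
  edge? : ∀ u z → Dec (matches (fixing p u) z ≡ true × F z ≡ true)
  edge? u z = (matches (fixing p u) z Bool.≟ true) ×-dec (F z Bool.≟ true)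

  nbr : Cube ∣ p ∣ → List (Cube ∣ ∁ p ∣)
  nbr u = List.map (restrict p) (List.filter (edge? u) S)

  degree : ∀ u → length (nbr u) ≤ D
  degree u = ≤-trans (≤-reflexive (List.length-map _ (List.filter (edge? u) S)))
               (≤-trans (length-filter-≤ (edge? u) proj₁ S) (hits≤D u))

  sound : ∀ {u v} → v ∈ nbr u → graph F p u v
  sound {u} v∈ with z , z∈ , refl ← ∈-map⁻ (restrict p) v∈
               with _ , match , Fz ← ∈-filter⁻ (edge? u) {xs = S} z∈
    = trans (cong F (combine-restrict p u z match)) Fz

  complete : ∀ {u v} → graph F p u v → v ∈ nbr u
  complete {u} {v} e = subst (_∈ nbr u) (restrict-combine p u v)
    (∈-map⁺ (restrict p) (∈-filter⁺ (edge? u) (support e) (matches-combine p u v , e)))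

-- Representability is decidable

any-in? : ∀ {xs : List A} {P : Pred A 0ℓ} → (∀ x → x ∈ xs) → Decidable P → Dec (∃ P)
any-in? {xs = xs} ∈xs P? = map′ Any.satisfied (λ (x , px) → lose (∈xs x) px) (Any.any? P? xs)

all-in? : ∀ {xs : List A} {P : Pred A 0ℓ} → (∀ x → x ∈ xs) → Decidable P → Dec (∀ x → P x)
all-in? {xs = xs} ∈xs P? = map′ (λ all x → All.lookup all (∈xs x)) (λ f → All.universal f xs) (All.all? P? xs)

anyCube? : ∀ {P : Pred (Cube d) 0ℓ} → Decidable P → Dec (∃ P)
anyCube? = any-in? ∈-cubes

allCubes? : ∀ {P : Pred (Cube d) 0ℓ} → Decidable P → Dec (∀ x → P x)
allCubes? = all-in? ∈-cubes

-- The search runs over bit vectors indexed by `xs`. Decoding the encoding of `f` gives a function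
-- equal to `f` only pointwise, hence the assumption that `P` respects `≗`.
anyPredicate? : ∀ {xs : List A} {P : Pred (A → Bool) 0ℓ} → (∀ x → x ∈ xs) →
                (∀ {f g} → f ≗ g → P f → P g) → Decidable P → Dec (∃ P)
anyPredicate? {A = A} {xs} ∈xs resp P? =
  map′ (λ (c , pc) → decode c , pc)
       (λ (f , pf) → encode f , resp (sym ∘ decode-encode f) pf)
       (anyCube? (P? ∘ decode))
  where
  decode : Cube (length xs) → A → Bool
  decode c x = Vec.lookup c (Any.index (∈xs x))

  encode : (A → Bool) → Cube (length xs)
  encode f = Vec.tabulate (f ∘ List.lookup xs)

  decode-encode : ∀ f → decode (encode f) ≗ f
  decode-encode f x = trans (Vec.lookup∘tabulate _ (Any.index (∈xs x)))
                            (cong f (sym (Any.lookup-index (∈xs x))))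

-- Strong induction on the witness: either a smaller one exists, or this one is least.
minimum : ∀ {P : Pred ℕ 0ℓ} → Decidable P → ∀ b → P b →
          ∃[ d ] ((P d × (∀ d′ → P d′ → d ≤ d′)) × d ≤ b)
minimum {P} P? = <-rec _ search
  where
  search : ∀ b → (∀ {c} → c < b → P c → ∃[ d ] ((P d × (∀ d′ → P d′ → d ≤ d′)) × d ≤ c)) →
           P b → ∃[ d ] ((P d × (∀ d′ → P d′ → d ≤ d′)) × d ≤ b)
  search b below Pb with anyUpTo? P? b
  ... | yes (c , c<b , Pc) = let d , least , d≤c = below c<b Pc in d , least , ≤-trans d≤c (<⇒≤ c<b)
  ... | no  none           = b , (Pb , λ d Pd → ≮⇒≥ λ d<b → none (d , d<b , Pd)) , ≤-refl

isBasis? : ∀ {W : Pred (Cube d) 0ℓ} → Decidable W → ∀ {k} (bs : Vec (Cube d) k) → Dec (IsBasis W bs)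
isBasis? W? bs = map′
  (λ (mem , ind , spn) → record { members = mem ; independent = ind ; spanning = λ {w} → spn w })
  (λ basis → let open IsBasis basis in members , independent , λ w → spanning {w})
  (VecAll.all? W? bs
    ×-dec allCubes? (λ cs → (combination cs bs ≟ⱽ 0ⱽ) →-dec (cs ≟ⱽ _))
    ×-dec allCubes? (λ w → W? w →-dec anyCube? (λ cs → combination cs bs ≟ⱽ w)))

hasDimension? : ∀ {W : Pred (Cube d) 0ℓ} → Decidable W → ∀ k → Dec (HasDimension W k)
hasDimension? W? k = any-in? (∈-vectors ∈-cubes) (isBasis? W?)

dim≤1? : ∀ {W : Pred (Cube d) 0ℓ} → Decidable W → Dec (∃[ k ] HasDimension W k × k ≤ 1)
dim≤1? W? = map′
  [ (λ h → 0 , h , z≤n) , (λ h → 1 , h , ≤-refl) ]′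
  (λ { (0 , h , _) → inj₁ h ; (1 , h , _) → inj₂ h ; (suc (suc _) , _ , s≤s ()) })
  (hasDimension? W? 0 ⊎-dec hasDimension? W? 1)

trivial? : ∀ {W : Pred (Cube d) 0ℓ} → Decidable W → Dec (W ≐ ｛ 0ⱽ ｝)
trivial? W? = map′
  (λ (to , from) → (λ {w} → to w) , (λ {w} → from w))
  (λ (to , from) → (λ w → to {w}) , (λ w → from {w}))
  (allCubes? (λ w → W? w →-dec (0ⱽ ≟ⱽ w)) ×-dec allCubes? (λ w → (0ⱽ ≟ⱽ w) →-dec W? w))

hasDimension-resp : ∀ {W W′ : Pred (Cube d) 0ℓ} {k} → W ≐ W′ → HasDimension W k → HasDimension W′ k
hasDimension-resp (to , from) (bs , basis) = bs , record
  { members     = VecAll.map to members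
  ; independent = independent
  ; spanning    = spanning ∘ from
  }
  where open IsBasis basis

-- The laws of `Subspace` as a condition on a membership test alone, with explicit arguments, so
-- that exhaustive search decides it.
IsSubspace : (Cube d → Bool) → Set
IsSubspace m = T (m 0ⱽ) × (∀ v w → T (m v) → T (m w) → T (m (v +ⱽ w)))
             × (∀ c v → T (m v) → T (m (c ·ⱽ v)))

isSubspace? : Decidable (IsSubspace {d})
isSubspace? m = T? (m 0ⱽ)
  ×-dec allCubes? (λ v → allCubes? λ w → T? (m v) →-dec (T? (m w) →-dec T? (m (v +ⱽ w))))
  ×-dec all-in? ∈-bools (λ c → allCubes? λ v → T? (m v) →-dec T? (m (c ·ⱽ v)))

subspace : (m : Cube d → Bool) → IsSubspace m → Subspace d
subspace m (0∈ , +∈ , ·∈) = record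
  { member = m ; 0-member = 0∈ ; +-closed = +∈ _ _ ; ·-closed = λ c → ·∈ c _ }

isSubspace : ∀ (S : Subspace d) {m} → Subspace.member S ≗ m → IsSubspace m
isSubspace S S≗m =
    subst T (S≗m 0ⱽ) 0-member
  , (λ v w v∈ w∈ → subst T (S≗m _) (+-closed (subst T (sym (S≗m v)) v∈) (subst T (sym (S≗m w)) w∈)))
  , (λ c v v∈ → subst T (S≗m _) (·-closed c (subst T (sym (S≗m v)) v∈)))
  where open Subspace S

module _ {U V : Set} {us : List U} (∈us : ∀ u → u ∈ us) {vs : List V} (∈vs : ∀ v → v ∈ vs)
         {_—_ : BipartiteGraph U V} (_—?_ : ∀ u v → Dec (u — v)) where

  private
    meet : (U ⊎ V → Subspace d) → U → V → Pred (Cube d) 0ℓ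
    meet φ u v = ⟦ φ (inj₁ u) ⟧ ∩ ⟦ φ (inj₂ v) ⟧

  isUpdRepresentation? : (φ : U ⊎ V → Subspace d) → Dec (IsUpdRepresentation _—_ φ)
  isUpdRepresentation? φ = map′
    (λ (nz , dim) → record
      { nonzero⇔edge = λ u v → mk⇔ (proj₁ (nz u v)) (proj₂ (nz u v)) ; dim≤1 = dim })
    (λ rep → let open IsUpdRepresentation rep in
      (λ u v → Equivalence.to (nonzero⇔edge u v) , Equivalence.from (nonzero⇔edge u v)) , dim≤1)
    (all-in? ∈us (λ u → all-in? ∈vs λ v →
        let nz? = ¬? (trivial? (meet? u v)) in (nz? →-dec (u —? v)) ×-dec ((u —? v) →-dec nz?))
      ×-dec all-in? ∈us (λ u → all-in? ∈vs λ v → dim≤1? (meet? u v)))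
    where
    meet? : ∀ u v → Decidable (meet φ u v)
    meet? u v w = T? _ ×-dec T? _

  isUpdRepresentation-resp : ∀ {φ ψ : U ⊎ V → Subspace d} →
    (∀ a → Subspace.member (φ a) ≗ Subspace.member (ψ a)) →
    IsUpdRepresentation _—_ φ → IsUpdRepresentation _—_ ψ
  isUpdRepresentation-resp {φ = φ} {ψ} φ≗ψ rep = record
    { nonzero⇔edge = λ u v → mk⇔
        (λ nz → Equivalence.to (nonzero⇔edge u v) (nz ∘ ≐-trans (≐-sym (φ≐ψ u v))))
        (λ e → Equivalence.from (nonzero⇔edge u v) e ∘ ≐-trans (φ≐ψ u v))
    ; dim≤1 = λ u v → let k , h , k≤1 = dim≤1 u v in k , hasDimension-resp (φ≐ψ u v) h , k≤1
    }
    where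
    open IsUpdRepresentation rep hiding (meet)
    φ≐ψ : ∀ u v → meet φ u v ≐ meet ψ u v
    φ≐ψ u v = (λ {w} (a , b) → subst T (φ≗ψ _ w) a , subst T (φ≗ψ _ w) b)
            , (λ {w} (a , b) → subst T (sym (φ≗ψ _ w)) a , subst T (sym (φ≗ψ _ w)) b)

  representable? : Decidable (Representable _—_)
  representable? d = map′
    (λ (_ , φ , _ , rep) → φ , rep)
    (λ (φ , rep) → (λ (a , v) → Subspace.member (φ a) v) , φ , (λ _ _ → refl) , rep)
    (anyPredicate? ∈-both realizes-resp realizes?)
    where
    ∈-U⊎V : (a : U ⊎ V) → a ∈ List.map inj₁ us List.++ List.map inj₂ vs
    ∈-U⊎V (inj₁ u) = ∈-++⁺ˡ (∈-map⁺ inj₁ (∈us u))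
    ∈-U⊎V (inj₂ v) = ∈-++⁺ʳ (List.map inj₁ us) (∈-map⁺ inj₂ (∈vs v))

    ∈-both : (av : (U ⊎ V) × Cube d) →
             av ∈ cartesianProduct (List.map inj₁ us List.++ List.map inj₂ vs) (cubes d)
    ∈-both (a , v) = ∈-cartesianProduct⁺ (∈-U⊎V a) (∈-cubes v)

    -- The search is over Boolean membership tables for all vertices at once: they are finite data,
    -- whereas `φ` also carries proofs.
    Realizes : Pred ((U ⊎ V) × Cube d → Bool) 0ℓ
    Realizes m = ∃[ φ ] ((∀ a v → Subspace.member (φ a) v ≡ m (a , v)) × IsUpdRepresentation _—_ φ)

    realizes-resp : ∀ {m m′} → m ≗ m′ → Realizes m → Realizes m′
    realizes-resp m≗m′ (φ , φ≗m , rep) = φ , (λ a v → trans (φ≗m a v) (m≗m′ (a , v))) , rep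

    realizes? : Decidable Realizes
    realizes? m with all-in? ∈-U⊎V (λ a → isSubspace? λ v → m (a , v))
    ... | no  ¬sub = no λ (φ , φ≗m , _) → ¬sub λ a → isSubspace (φ a) (φ≗m a)
    ... | yes sub with isUpdRepresentation? (λ a → subspace _ (sub a))
    ...   | yes rep = yes (_ , (λ _ _ → refl) , rep)
    -- Being a representation depends only on membership, so testing one family with this table
    -- settles all of them.
    ...   | no ¬rep = no λ (φ , φ≗m , rep) → ¬rep (isUpdRepresentation-resp φ≗m rep)

  upd-exists : ∀ {b} → Representable _—_ b → ∃[ d ] (IsUpd _—_ d × d ≤ b)
  upd-exists = minimum representable? _

-- The hard function

module _ (n : ℕ) (n≥1 : n ≥ 1) where

  private
    -- Rounding down gives `8 * m ≤ 2 ^ n` for `sparseSet`, and loses little enough for `large`.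
    m = 2 ^ n / 8

    sparse : ∃[ S ] (Unique S × length S ≡ m ×
                     (∀ (q : Pattern (n + n)) → stars q ≤ n → hits q S ≤ 1 + 4 * n))
    sparse = sparseSet n m n≥1 (≤-trans (≤-reflexive (*-comm 8 m)) (m/n*n≤m (2 ^ n) 8))

    S : List (Cube (n + n))
    S = proj₁ sparse

    large : 2 ^ n ≤ 8 * (1 + length S)
    large = subst (λ l → 2 ^ n ≤ 8 * (1 + l)) (sym (proj₁ (proj₂ (proj₂ sparse))))
              (begin
                2 ^ n                    ≡⟨ m≡m%n+[m/n]*n (2 ^ n) 8 ⟩
                2 ^ n % 8 + m * 8        ≤⟨ +-monoˡ-≤ (m * 8) (m%n≤n (2 ^ n) 8) ⟩
                (1 + m) * 8              ≡⟨ *-comm (1 + m) 8 ⟩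
                8 * (1 + m)              ∎)
      where open ≤-Reasoning

    values : Cube (length S)
    values = proj₁ (hardValues n≥1 S large)

  hard : Cube n × Cube n → Bool
  hard (u , v) = select S values (u Vec.++ v)

  private
    uncut-hard : uncut n hard ≗ select S values
    uncut-hard z = cong (select S values) (Vec.take++drop≡id n z)

  hard-size : (P : BranchingProgram (n + n)) → Computes P (uncut n hard) →
              2 ^ n ≤ 48 * (n * size P)
  hard-size P comp = proj₂ (hardValues n≥1 S large) P comp
    (trans (Vec.map-cong uncut-hard (Vec.fromList S)) (evaluate-select (proj₁ (proj₂ sparse)) values))

  hard-representable : (p : Subset (n + n)) → Balanced n p →
                       Representable (graph (uncut n hard) p) (2 + 6 * n)
  hard-representable p (∣p∣≡n , ∣∁p∣≡n) = sparse⇒representable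
    (λ {z} hz → select⇒∈ S values (trans (sym (uncut-hard z)) hz)) p
    (λ u → proj₂ (proj₂ (proj₂ sparse)) (fixing p u) (≤-reflexive (trans (stars-fixing p u) ∣∁p∣≡n)))
    (begin-strict
      2 ^ ∣ p ∣ * 2 ^ ∣ ∁ p ∣ * 2 ^ (1 + 4 * n)
        ≡⟨ cong₂ (λ a b → 2 ^ a * 2 ^ b * 2 ^ (1 + 4 * n)) ∣p∣≡n ∣∁p∣≡n ⟩
      2 ^ n * 2 ^ n * 2 ^ (1 + 4 * n)
        ≡⟨ cong (_* 2 ^ (1 + 4 * n)) (^-distribˡ-+-* 2 n n) ⟨
      2 ^ (n + n) * 2 ^ (1 + 4 * n)
        ≡⟨ ^-distribˡ-+-* 2 (n + n) (1 + 4 * n) ⟨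
      2 ^ (n + n + (1 + 4 * n))
        -- The exponent consists of `n + n` for the pairs of vertices and `1 + 4 * n` for the
        -- degree; one more dimension makes the inequality strict.
        <⟨ ^-monoʳ-< 2 (s≤s (s≤s z≤n)) (≤-reflexive (exponent n)) ⟩
      2 ^ (2 + 6 * n) ∎)
    where
    open ≤-Reasoning
    exponent : ∀ n → 1 + (n + n + (1 + 4 * n)) ≡ 2 + 6 * n
    exponent = solve-∀

  hard-upd : (p : Subset (n + n)) → Balanced n p →
             ∃[ d ] (IsUpd (graph (uncut n hard) p) d × d ≤ 8 * n)
  hard-upd p balanced =
    let d , isUpd , d≤ = upd-exists ∈-cubes ∈-cubes (λ u v → uncut n hard (combine p u v) Bool.≟ true)
                           (hard-representable p balanced)
    in d , isUpd , ≤-trans d≤ (begin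
         -- Here `n ≥ 1` absorbs the additive constant.
         2 + 6 * n      ≤⟨ +-monoˡ-≤ (6 * n) (*-monoʳ-≤ 2 n≥1) ⟩
         2 * n + 6 * n  ≡⟨ *-distribʳ-+ n 2 6 ⟨
         8 * n          ∎)
    where open ≤-Reasoning

hardFunction : ∀ n → Cube n × Cube n → Bool
-- A default value; the bounds are claimed for `n ≥ 1`.
hardFunction zero    = const false
hardFunction (suc n) = hard (suc n) z<s

proposition5p1 : Σ[ K ∈ ℕ ] Σ[ C ∈ ℕ ] Σ[ f ∈ ((n : ℕ) → Cube n × Cube n → Bool) ]
    (K ≥ 1 ×
    ((n : ℕ) → n ≥ 1 →
    ((P : BranchingProgram (n + n)) → Computes P (uncut n (f n)) →
    2 ^ n ≤ K * (n * size P))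
    ×
    ((p : Subset (n + n)) → Balanced n p →
    ∃[ d ] (IsUpd (graph (uncut n (f n)) p) d × d ≤ C * n))))
proposition5p1 = 48 , 8 , hardFunction , z<s , λ { (suc n) _ → hard-size (suc n) z<s , hard-upd (suc n) z<s }
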